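{- Let $q=2^r$ ($r\ge 1$), $\sigma\in\mathrm{Aut}(\mathbb{F}_q)$, and $R=\mathbb{F}_q[X;\sigma]/(X^2)$. Then there is no projective $\bigl((q^4-q)/2,\,q^2/2\bigr)$-arc in $\mathrm{PHG}(2,R)$; equivalently, $\mathrm{m}_{q^2/2}(R)<(q^4-q)/2$.
   Context: $\mathbb{F}_q[X;\sigma]$ is the skew polynomial ring with commutation rule $Xa=\sigma(a)X$; $R=\mathbb{F}_q[X;\sigma]/(X^2)$ is a chain ring of length $2$ and characteristic $2$ with residue field $\mathbb{F}_q$. The projective Hjelmslev plane $\mathrm{PHG}(2,R)$ is the incidence structure whose points are the free rank-$1$ submodules of the right module $R_R^3$, whose lines are the free rank-$2$ submodules of $R_R^3$, with incidence given by inclusion. A projective $(k,n)$-arc is a set of $k$ points meeting every line in at most $n$ points. For $0\le n\le q^2+q$, $\mathrm{m}_n(R)$ denotes the largest $k$ such that a projective $(k,n)$-arc exists in $\mathrm{PHG}(2,R)$. -}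

module Defs where

open import Algebra.Bundles using (CommutativeRing; Ring)
open import Algebra.Definitions.RawMonoid using (sum)
open import Algebra.Module.Bundles using (RightModule)
open import Algebra.Morphism.Structures using (module RingMorphisms)
import Algebra.Module.Construct.DirectProduct as DirectProduct
import Algebra.Module.Construct.TensorUnit as TensorUnit
import Algebra.Properties.AbelianGroup as AbelianGroupProperties
import Algebra.Properties.CommutativeSemigroup as CommutativeSemigroupProperties
import Algebra.Properties.Ring as RingProperties
open import Data.Fin.Base using (Fin)
open import Data.Fin.Subset using (Subset; _∈_; ∣_∣)
open import Data.List.Base using (List; []; _∷_; map)
open import Data.Nat.Base using (ℕ; zero; suc; _≤_)
open import Data.Product.Base using (Σ; ∃; _×_; _,_; proj₁; proj₂)
open import Function.Bundles using (Inverse)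
open import Level using (Level; _⊔_) renaming (suc to lsuc)
open import Relation.Binary.PropositionalEquality as ≡ using (_≡_)
import Relation.Binary.Reasoning.Setoid as SetoidReasoning
open import Relation.Binary.Structures using (IsEquivalence)
open import Relation.Nullary.Negation.Core using (¬_)
open import Relation.Unary using (Pred)

record IsFiniteField {c ℓ : Level} (F : CommutativeRing c ℓ) (q : ℕ) : Set (c ⊔ ℓ) where
  open CommutativeRing F
  field
    1≉0         : ¬ (1# ≈ 0#)
    invertible  : ∀ x → ¬ (x ≈ 0#) → ∃ λ y → x * y ≈ 1#
    enumeration : Inverse setoid (≡.setoid (Fin q))

IsAutomorphism : {c ℓ : Level} (F : CommutativeRing c ℓ) →
                 (CommutativeRing.Carrier F → CommutativeRing.Carrier F) → Set (c ⊔ ℓ)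
IsAutomorphism F σ = IsRingIsomorphism σ
  where
  open CommutativeRing F using (rawRing)
  open RingMorphisms rawRing rawRing using (IsRingIsomorphism)

-- The list a₀ ∷ a₁ ∷ … ∷ [] stands for Σ aᵢ Xⁱ (coefficients on the left);
-- trailing zeros are irrelevant, so equality is coefficientwise.

module SkewPolynomial {c ℓ : Level} (F : CommutativeRing c ℓ)
                      (σ : CommutativeRing.Carrier F → CommutativeRing.Carrier F)
                      (σ-aut : IsAutomorphism F σ) where

  open CommutativeRing F renaming (Carrier to K)
  open RingMorphisms rawRing rawRing using (module IsRingIsomorphism)
  open IsRingIsomorphism σ-aut using (⟦⟧-cong; +-homo; *-homo; 0#-homo; 1#-homo)
  open RingProperties ring using (-0#≈0#)
  open CommutativeSemigroupProperties +-commutativeSemigroup using (interchange)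

  Poly : Set c
  Poly = List K

  coeff : Poly → ℕ → K
  coeff []      _       = 0#
  coeff (a ∷ p) zero    = a
  coeff (a ∷ p) (suc i) = coeff p i

  infix 4 _≋_
  record _≋_ (p q : Poly) : Set ℓ where
    constructor mk≋
    field coeff≈ : ∀ i → coeff p i ≈ coeff q i
  open _≋_ public

  infixl 6 _⊕_
  _⊕_ : Poly → Poly → Poly
  []      ⊕ q       = q
  (a ∷ p) ⊕ []      = a ∷ p
  (a ∷ p) ⊕ (b ∷ q) = (a + b) ∷ (p ⊕ q)

  ⊖_ : Poly → Poly
  ⊖_ = map (-_)

  infixr 8 _·_
  _·_ : K → Poly → Poly
  a · p = map (a *_) p

  -- (a + pX) q = aq + p (Xq), and Xq = σ(q) X by the rule Xb = σ(b)X.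
  infixl 7 _⊛_
  _⊛_ : Poly → Poly → Poly
  []      ⊛ q = []
  (a ∷ p) ⊛ q = a · q ⊕ (0# ∷ (p ⊛ map σ q))

  X² : Poly
  X² = 0# ∷ 0# ∷ 1# ∷ []

  coeff-⊕ : ∀ p q i → coeff (p ⊕ q) i ≈ coeff p i + coeff q i
  coeff-⊕ []      q       i       = sym (+-identityˡ _)
  coeff-⊕ (a ∷ p) []      i       = sym (+-identityʳ _)
  coeff-⊕ (a ∷ p) (b ∷ q) zero    = refl
  coeff-⊕ (a ∷ p) (b ∷ q) (suc i) = coeff-⊕ p q i

  coeff-map : ∀ (f : K → K) → f 0# ≈ 0# → ∀ p i → coeff (map f p) i ≈ f (coeff p i)
  coeff-map f f0 []      i       = sym f0
  coeff-map f f0 (a ∷ p) zero    = refl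
  coeff-map f f0 (a ∷ p) (suc i) = coeff-map f f0 p i

  coeff-⊖ : ∀ p i → coeff (⊖ p) i ≈ - coeff p i
  coeff-⊖ = coeff-map (-_) -0#≈0#

  coeff-· : ∀ a p i → coeff (a · p) i ≈ a * coeff p i
  coeff-· a = coeff-map (a *_) (zeroʳ a)

  coeff-σ : ∀ p i → coeff (map σ p) i ≈ σ (coeff p i)
  coeff-σ = coeff-map σ 0#-homo

  ≋-isEquivalence : IsEquivalence _≋_
  ≋-isEquivalence = record
    { refl  = mk≋ λ _ → refl
    ; sym   = λ e → mk≋ λ i → sym (coeff≈ e i)
    ; trans = λ e f → mk≋ λ i → trans (coeff≈ e i) (coeff≈ f i)
    }

  open IsEquivalence ≋-isEquivalence using ()
    renaming (refl to ≋-refl; sym to ≋-sym; trans to ≋-trans)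

  ∷-cong : ∀ {a b p q} → a ≈ b → p ≋ q → (a ∷ p) ≋ (b ∷ q)
  ∷-cong {a} {b} {p} {q} e f = mk≋ go
    where
    go : ∀ i → coeff (a ∷ p) i ≈ coeff (b ∷ q) i
    go zero    = e
    go (suc i) = coeff≈ f i

  tail≋ : ∀ {a b p q} → (a ∷ p) ≋ (b ∷ q) → p ≋ q
  tail≋ e = mk≋ λ i → coeff≈ e (suc i)

  0∷[] : (0# ∷ []) ≋ []
  0∷[] = mk≋ λ { zero → refl ; (suc i) → refl }

  ⊕-cong : ∀ {p p′ q q′} → p ≋ p′ → q ≋ q′ → p ⊕ q ≋ p′ ⊕ q′
  ⊕-cong {p} {p′} {q} {q′} e f = mk≋ λ i →
    trans (coeff-⊕ p q i)
      (trans (+-cong (coeff≈ e i) (coeff≈ f i)) (sym (coeff-⊕ p′ q′ i)))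

  ⊕-assoc : ∀ p q s → (p ⊕ q) ⊕ s ≋ p ⊕ (q ⊕ s)
  ⊕-assoc p q s = mk≋ λ i →
    trans (coeff-⊕ (p ⊕ q) s i)
      (trans (+-congʳ (coeff-⊕ p q i))
        (trans (+-assoc _ _ _)
          (trans (+-congˡ (sym (coeff-⊕ q s i))) (sym (coeff-⊕ p (q ⊕ s) i)))))

  ⊕-comm : ∀ p q → p ⊕ q ≋ q ⊕ p
  ⊕-comm p q = mk≋ λ i →
    trans (coeff-⊕ p q i) (trans (+-comm _ _) (sym (coeff-⊕ q p i)))

  ⊕-identityʳ : ∀ p → p ⊕ [] ≋ p
  ⊕-identityʳ p = ⊕-comm p []

  ⊖-cong : ∀ {p q} → p ≋ q → ⊖ p ≋ ⊖ q
  ⊖-cong {p} {q} e = mk≋ λ i →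
    trans (coeff-⊖ p i) (trans (-‿cong (coeff≈ e i)) (sym (coeff-⊖ q i)))

  ⊖-inverseˡ : ∀ p → ⊖ p ⊕ p ≋ []
  ⊖-inverseˡ p = mk≋ λ i →
    trans (coeff-⊕ (⊖ p) p i) (trans (+-congʳ (coeff-⊖ p i)) (-‿inverseˡ _))

  ⊖-inverseʳ : ∀ p → p ⊕ ⊖ p ≋ []
  ⊖-inverseʳ p = ≋-trans (⊕-comm p (⊖ p)) (⊖-inverseˡ p)

  ⊕-interchange : ∀ p q s t → (p ⊕ q) ⊕ (s ⊕ t) ≋ (p ⊕ s) ⊕ (q ⊕ t)
  ⊕-interchange p q s t = mk≋ λ i →
    trans (coeff-⊕ (p ⊕ q) (s ⊕ t) i)
      (trans (+-cong (coeff-⊕ p q i) (coeff-⊕ s t i))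
        (trans (interchange _ _ _ _)
          (trans (+-cong (sym (coeff-⊕ p s i)) (sym (coeff-⊕ q t i)))
            (sym (coeff-⊕ (p ⊕ s) (q ⊕ t) i)))))

  ·-cong : ∀ {a b p q} → a ≈ b → p ≋ q → a · p ≋ b · q
  ·-cong {a} {b} {p} {q} e f = mk≋ λ i →
    trans (coeff-· a p i) (trans (*-cong e (coeff≈ f i)) (sym (coeff-· b q i)))

  ·-zeroˡ : ∀ p → 0# · p ≋ []
  ·-zeroˡ p = mk≋ λ i → trans (coeff-· 0# p i) (zeroˡ _)

  ·-distrib-⊕ : ∀ a p q → a · (p ⊕ q) ≋ a · p ⊕ a · q
  ·-distrib-⊕ a p q = mk≋ λ i →
    trans (coeff-· a (p ⊕ q) i)
      (trans (*-congˡ (coeff-⊕ p q i))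
        (trans (distribˡ _ _ _)
          (trans (+-cong (sym (coeff-· a p i)) (sym (coeff-· a q i)))
            (sym (coeff-⊕ (a · p) (a · q) i)))))

  ·-distrib-+ : ∀ a b p → (a + b) · p ≋ a · p ⊕ b · p
  ·-distrib-+ a b p = mk≋ λ i →
    trans (coeff-· (a + b) p i)
      (trans (distribʳ _ _ _)
        (trans (+-cong (sym (coeff-· a p i)) (sym (coeff-· b p i)))
          (sym (coeff-⊕ (a · p) (b · p) i))))

  ·-assoc : ∀ a b p → (a * b) · p ≋ a · b · p
  ·-assoc a b p = mk≋ λ i →
    trans (coeff-· (a * b) p i)
      (trans (*-assoc _ _ _)
        (trans (*-congˡ (sym (coeff-· b p i))) (sym (coeff-· a (b · p) i))))

  ·-identity : ∀ p → 1# · p ≋ p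
  ·-identity p = mk≋ λ i → trans (coeff-· 1# p i) (*-identityˡ _)

  σ-cong : ∀ {p q} → p ≋ q → map σ p ≋ map σ q
  σ-cong {p} {q} e = mk≋ λ i →
    trans (coeff-σ p i) (trans (⟦⟧-cong (coeff≈ e i)) (sym (coeff-σ q i)))

  σ-⊕ : ∀ p q → map σ (p ⊕ q) ≋ map σ p ⊕ map σ q
  σ-⊕ p q = mk≋ λ i →
    trans (coeff-σ (p ⊕ q) i)
      (trans (⟦⟧-cong (coeff-⊕ p q i))
        (trans (+-homo _ _)
          (trans (+-cong (sym (coeff-σ p i)) (sym (coeff-σ q i)))
            (sym (coeff-⊕ (map σ p) (map σ q) i)))))

  σ-· : ∀ a p → map σ (a · p) ≋ σ a · map σ p
  σ-· a p = mk≋ λ i →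
    trans (coeff-σ (a · p) i)
      (trans (⟦⟧-cong (coeff-· a p i))
        (trans (*-homo _ _)
          (trans (*-congˡ (sym (coeff-σ p i))) (sym (coeff-· (σ a) (map σ p) i)))))

  ⊛-congˡ : ∀ p {q q′} → q ≋ q′ → p ⊛ q ≋ p ⊛ q′
  ⊛-congˡ []      e = ≋-refl
  ⊛-congˡ (a ∷ p) e = ⊕-cong (·-cong refl e) (∷-cong refl (⊛-congˡ p (σ-cong e)))

  ⊛-null : ∀ p q → p ≋ [] → p ⊛ q ≋ []
  ⊛-null []      q e = ≋-refl
  ⊛-null (a ∷ p) q e =
    ⊕-cong (≋-trans (·-cong (coeff≈ e 0) ≋-refl) (·-zeroˡ q))
           (≋-trans (∷-cong refl (⊛-null p (map σ q) (mk≋ λ i → coeff≈ e (suc i)))) 0∷[])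

  ⊛-congʳ : ∀ p p′ q → p ≋ p′ → p ⊛ q ≋ p′ ⊛ q
  ⊛-congʳ []      p′       q e = ≋-sym (⊛-null p′ q (≋-sym e))
  ⊛-congʳ (a ∷ p) []       q e = ⊛-null (a ∷ p) q e
  ⊛-congʳ (a ∷ p) (b ∷ p′) q e =
    ⊕-cong (·-cong (coeff≈ e 0) ≋-refl)
           (∷-cong refl (⊛-congʳ p p′ (map σ q) (tail≋ e)))

  ⊛-cong : ∀ {p p′ q q′} → p ≋ p′ → q ≋ q′ → p ⊛ q ≋ p′ ⊛ q′
  ⊛-cong {p} {p′} {q} e f = ≋-trans (⊛-congʳ p p′ q e) (⊛-congˡ p′ f)

  shift-⊕ : ∀ p q → (0# ∷ (p ⊕ q)) ≋ (0# ∷ p) ⊕ (0# ∷ q)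
  shift-⊕ p q = ∷-cong (sym (+-identityˡ 0#)) ≋-refl

  ⊛-distribˡ : ∀ p q s → p ⊛ (q ⊕ s) ≋ p ⊛ q ⊕ p ⊛ s
  ⊛-distribˡ []      q s = ≋-refl
  ⊛-distribˡ (a ∷ p) q s = ≋-trans
    (⊕-cong (·-distrib-⊕ a q s)
            (≋-trans (∷-cong refl (≋-trans (⊛-congˡ p (σ-⊕ q s))
                                            (⊛-distribˡ p (map σ q) (map σ s))))
                     (shift-⊕ (p ⊛ map σ q) (p ⊛ map σ s))))
    (⊕-interchange (a · q) (a · s) (0# ∷ (p ⊛ map σ q)) (0# ∷ (p ⊛ map σ s)))

  ⊛-distribʳ : ∀ q p s → (p ⊕ s) ⊛ q ≋ p ⊛ q ⊕ s ⊛ q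
  ⊛-distribʳ q []      s       = ≋-refl
  ⊛-distribʳ q (a ∷ p) []      = ≋-sym (⊕-identityʳ ((a ∷ p) ⊛ q))
  ⊛-distribʳ q (a ∷ p) (b ∷ s) = ≋-trans
    (⊕-cong (·-distrib-+ a b q)
            (≋-trans (∷-cong refl (⊛-distribʳ (map σ q) p s))
                     (shift-⊕ (p ⊛ map σ q) (s ⊛ map σ q))))
    (⊕-interchange (a · q) (b · q) (0# ∷ (p ⊛ map σ q)) (0# ∷ (s ⊛ map σ q)))

  ·-⊛ : ∀ a p q → (a · p) ⊛ q ≋ a · (p ⊛ q)
  ·-⊛ a []      q = ≋-refl
  ·-⊛ a (b ∷ p) q = ≋-trans
    (⊕-cong (·-assoc a b q)
            (∷-cong (sym (zeroʳ a)) (·-⊛ a p (map σ q))))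
    (≋-sym (·-distrib-⊕ a (b · q) (0# ∷ (p ⊛ map σ q))))

  shift-⊛ : ∀ p q → (0# ∷ p) ⊛ q ≋ 0# ∷ (p ⊛ map σ q)
  shift-⊛ p q = ⊕-cong (·-zeroˡ q) ≋-refl

  σ-⊛ : ∀ p q → map σ (p ⊛ q) ≋ map σ p ⊛ map σ q
  σ-⊛ []      q = ≋-refl
  σ-⊛ (a ∷ p) q = ≋-trans
    (σ-⊕ (a · q) (0# ∷ (p ⊛ map σ q)))
    (⊕-cong (σ-· a q) (∷-cong 0#-homo (σ-⊛ p (map σ q))))

  ⊛-assoc : ∀ p q s → (p ⊛ q) ⊛ s ≋ p ⊛ (q ⊛ s)
  ⊛-assoc []      q s = ≋-refl
  ⊛-assoc (a ∷ p) q s = ≋-trans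
    (⊛-distribʳ s (a · q) (0# ∷ (p ⊛ map σ q)))
    (⊕-cong (·-⊛ a q s)
            (≋-trans (shift-⊛ (p ⊛ map σ q) s)
              (∷-cong refl
                (≋-trans (⊛-assoc p (map σ q) (map σ s))
                         (⊛-congˡ p (≋-sym (σ-⊛ q s)))))))

  ⊛-identityˡ : ∀ p → (1# ∷ []) ⊛ p ≋ p
  ⊛-identityˡ p = ≋-trans (⊕-cong (·-identity p) 0∷[]) (⊕-identityʳ p)

  ⊛-identityʳ : ∀ p → p ⊛ (1# ∷ []) ≋ p
  ⊛-identityʳ []      = ≋-refl
  ⊛-identityʳ (a ∷ p) = ∷-cong
    (trans (+-identityʳ _) (*-identityʳ a))
    (≋-trans (⊛-congˡ p (∷-cong 1#-homo ≋-refl)) (⊛-identityʳ p))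

  skewPolynomialRing : Ring c ℓ
  skewPolynomialRing = record
    { Carrier = Poly
    ; _≈_     = _≋_
    ; _+_     = _⊕_
    ; _*_     = _⊛_
    ; -_      = ⊖_
    ; 0#      = []
    ; 1#      = 1# ∷ []
    ; isRing  = record
      { +-isAbelianGroup = record
        { isGroup = record
          { isMonoid = record
            { isSemigroup = record
              { isMagma = record { isEquivalence = ≋-isEquivalence ; ∙-cong = ⊕-cong }
              ; assoc   = ⊕-assoc
              }
            ; identity = (λ _ → ≋-refl) , ⊕-identityʳ
            }
          ; inverse = ⊖-inverseˡ , ⊖-inverseʳ
          ; ⁻¹-cong = ⊖-cong
          }
        ; comm = ⊕-comm
        }
      ; *-cong     = ⊛-cong
      ; *-assoc    = ⊛-assoc
      ; *-identity = ⊛-identityˡ , ⊛-identityʳ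
      ; distrib    = ⊛-distribˡ , ⊛-distribʳ
      }
    }

module PrincipalQuotient {c ℓ : Level} (A : Ring c ℓ) (g : Ring.Carrier A) where

  open Ring A
  open RingProperties A using (-‿distribˡ-*; -‿distribʳ-*)
  open AbelianGroupProperties +-abelianGroup using (⁻¹-involutive; ⁻¹-∙-comm)
  open CommutativeSemigroupProperties +-commutativeSemigroup using (interchange)

  -- The two-sided ideal generated by g; it contains 0 = 0 g and -x = (-1) x.
  data ⟨g⟩ : Carrier → Set (c ⊔ ℓ) where
    generator : ⟨g⟩ g
    respects  : ∀ {x y} → x ≈ y → ⟨g⟩ x → ⟨g⟩ y
    +-closed  : ∀ {x y} → ⟨g⟩ x → ⟨g⟩ y → ⟨g⟩ (x + y)
    *-closedˡ : ∀ a {x} → ⟨g⟩ x → ⟨g⟩ (a * x)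
    *-closedʳ : ∀ {x} a → ⟨g⟩ x → ⟨g⟩ (x * a)

  infix 4 _≈/_
  record _≈/_ (x y : Carrier) : Set (c ⊔ ℓ) where
    constructor mk≈/
    field difference : ⟨g⟩ (x - y)
  open _≈/_ public

  open SetoidReasoning setoid

  0∈ : ⟨g⟩ 0#
  0∈ = respects (zeroˡ g) (*-closedˡ 0# generator)

  -∈ : ∀ {x} → ⟨g⟩ x → ⟨g⟩ (- x)
  -∈ {x} i = respects
    (trans (sym (-‿distribˡ-* 1# x)) (-‿cong (*-identityˡ x)))
    (*-closedˡ (- 1#) i)

  ≈⇒≈/ : ∀ {x y} → x ≈ y → x ≈/ y
  ≈⇒≈/ {x} {y} e =
    mk≈/ (respects (sym (trans (+-congʳ e) (-‿inverseʳ y))) 0∈)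

  telescope : ∀ x y z → (x - y) + (y - z) ≈ x - z
  telescope x y z = begin
    (x - y) + (y - z)     ≈⟨ +-assoc x (- y) (y - z) ⟩
    x + (- y + (y - z))   ≈⟨ +-congˡ (sym (+-assoc (- y) y (- z))) ⟩
    x + ((- y + y) - z)   ≈⟨ +-congˡ (+-congʳ (-‿inverseˡ y)) ⟩
    x + (0# - z)          ≈⟨ +-congˡ (+-identityˡ (- z)) ⟩
    x - z                 ∎

  swap- : ∀ x y → - (x - y) ≈ y - x
  swap- x y = begin
    - (x - y)      ≈⟨ sym (⁻¹-∙-comm x (- y)) ⟩
    - x + - (- y)  ≈⟨ +-congˡ (⁻¹-involutive y) ⟩
    - x + y        ≈⟨ +-comm (- x) y ⟩
    y - x          ∎

  +-diff : ∀ x x′ y y′ → (x - x′) + (y - y′) ≈ (x + y) - (x′ + y′)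
  +-diff x x′ y y′ = begin
    (x - x′) + (y - y′)      ≈⟨ interchange x (- x′) y (- y′) ⟩
    (x + y) + (- x′ + - y′)  ≈⟨ +-congˡ (⁻¹-∙-comm x′ y′) ⟩
    (x + y) - (x′ + y′)      ∎

  *-diff : ∀ x x′ y y′ → (x - x′) * y + x′ * (y - y′) ≈ x * y - x′ * y′
  *-diff x x′ y y′ = begin
    (x - x′) * y + x′ * (y - y′)
      ≈⟨ +-cong (distribʳ y x (- x′)) (distribˡ x′ y (- y′)) ⟩
    (x * y + (- x′) * y) + (x′ * y + x′ * (- y′))
      ≈⟨ +-cong (+-congˡ (sym (-‿distribˡ-* x′ y)))
                (+-congˡ (sym (-‿distribʳ-* x′ y′))) ⟩
    (x * y - x′ * y) + (x′ * y - x′ * y′)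
      ≈⟨ telescope (x * y) (x′ * y) (x′ * y′) ⟩
    x * y - x′ * y′ ∎

  ≈/-isEquivalence : IsEquivalence _≈/_
  ≈/-isEquivalence = record
    { refl  = ≈⇒≈/ refl
    ; sym   = λ {x} {y} e → mk≈/ (respects (swap- x y) (-∈ (difference e)))
    ; trans = λ {x} {y} {z} e f →
        mk≈/ (respects (telescope x y z) (+-closed (difference e) (difference f)))
    }

  +-cong/ : ∀ {x x′ y y′} → x ≈/ x′ → y ≈/ y′ → x + y ≈/ x′ + y′
  +-cong/ {x} {x′} {y} {y′} e f =
    mk≈/ (respects (+-diff x x′ y y′) (+-closed (difference e) (difference f)))

  -‿cong/ : ∀ {x y} → x ≈/ y → - x ≈/ - y
  -‿cong/ {x} {y} e =
    mk≈/ (respects (sym (⁻¹-∙-comm x (- y))) (-∈ (difference e)))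

  *-cong/ : ∀ {x x′ y y′} → x ≈/ x′ → y ≈/ y′ → x * y ≈/ x′ * y′
  *-cong/ {x} {x′} {y} {y′} e f =
    mk≈/ (respects (*-diff x x′ y y′)
      (+-closed (*-closedʳ y (difference e)) (*-closedˡ x′ (difference f))))

  quotientRing : Ring c (c ⊔ ℓ)
  quotientRing = record
    { Carrier = Carrier
    ; _≈_     = _≈/_
    ; _+_     = _+_
    ; _*_     = _*_
    ; -_      = -_
    ; 0#      = 0#
    ; 1#      = 1#
    ; isRing  = record
      { +-isAbelianGroup = record
        { isGroup = record
          { isMonoid = record
            { isSemigroup = record
              { isMagma = record { isEquivalence = ≈/-isEquivalence ; ∙-cong = +-cong/ }
              ; assoc   = λ x y z → ≈⇒≈/ (+-assoc x y z)
              }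
            ; identity = (λ x → ≈⇒≈/ (+-identityˡ x)) , (λ x → ≈⇒≈/ (+-identityʳ x))
            }
          ; inverse = (λ x → ≈⇒≈/ (-‿inverseˡ x)) , (λ x → ≈⇒≈/ (-‿inverseʳ x))
          ; ⁻¹-cong = -‿cong/
          }
        ; comm = λ x y → ≈⇒≈/ (+-comm x y)
        }
      ; *-cong     = *-cong/
      ; *-assoc    = λ x y z → ≈⇒≈/ (*-assoc x y z)
      ; *-identity = (λ x → ≈⇒≈/ (*-identityˡ x)) , (λ x → ≈⇒≈/ (*-identityʳ x))
      ; distrib    = (λ x y z → ≈⇒≈/ (distribˡ x y z)) , (λ x y z → ≈⇒≈/ (distribʳ x y z))
      }
    }

_[X⨟_]/X² : {c ℓ : Level} (F : CommutativeRing c ℓ)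
            (σ : Σ (CommutativeRing.Carrier F → CommutativeRing.Carrier F) (IsAutomorphism F)) →
            Ring c (c ⊔ ℓ)
F [X⨟ σ , σ-aut ]/X² = PrincipalQuotient.quotientRing skewPolynomialRing X²
  where open SkewPolynomial F σ σ-aut

module PHG {c ℓ : Level} (R : Ring c ℓ) where

  R³ : RightModule R c ℓ
  R³ = DirectProduct.rightModule R¹ (DirectProduct.rightModule R¹ R¹)
    where
    R¹ : RightModule R c ℓ
    R¹ = TensorUnit.rightModule {R = R}

  open Ring R using () renaming (Carrier to Scalar; _≈_ to _≈ₛ_; 0# to 0ₛ)
  open RightModule R³ using (Carrierᴹ; _≈ᴹ_; _+ᴹ_; 0ᴹ; _*ᵣ_; +ᴹ-rawMonoid)

  record Submodule : Set (lsuc (c ⊔ ℓ)) where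
    field
      Member     : Pred Carrierᴹ (c ⊔ ℓ)
      respects   : ∀ {u v} → u ≈ᴹ v → Member u → Member v
      0-closed   : Member 0ᴹ
      +-closed   : ∀ {u v} → Member u → Member v → Member (u +ᴹ v)
      *ᵣ-closed  : ∀ {u} a → Member u → Member (u *ᵣ a)
  open Submodule public using (Member)

  infix 4 _⊆_ _≐_
  _⊆_ : Submodule → Submodule → Set (c ⊔ ℓ)
  U ⊆ V = ∀ v → Member U v → Member V v

  _≐_ : Submodule → Submodule → Set (c ⊔ ℓ)
  U ≐ V = (U ⊆ V) × (V ⊆ U)

  combination : ∀ {d} → (Fin d → Carrierᴹ) → (Fin d → Scalar) → Carrierᴹ
  combination b a = sum +ᴹ-rawMonoid (λ i → b i *ᵣ a i)

  record IsFreeOfRank (d : ℕ) (U : Submodule) : Set (c ⊔ ℓ) where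
    field
      basis       : Fin d → Carrierᴹ
      basis∈      : ∀ i → Member U (basis i)
      spanning    : ∀ u → Member U u → ∃ λ a → u ≈ᴹ combination basis a
      independent : ∀ a → combination basis a ≈ᴹ 0ᴹ → ∀ i → a i ≈ₛ 0ₛ

  Point : Set (lsuc (c ⊔ ℓ))
  Point = Σ Submodule (IsFreeOfRank 1)

  Line : Set (lsuc (c ⊔ ℓ))
  Line = Σ Submodule (IsFreeOfRank 2)

  infix 4 _≈ₚ_ _on_
  _≈ₚ_ : Point → Point → Set (c ⊔ ℓ)
  P ≈ₚ Q = proj₁ P ≐ proj₁ Q

  _on_ : Point → Line → Set (c ⊔ ℓ)
  P on L = proj₁ P ⊆ proj₁ L

  -- "At most n of the k points lie on L" is expressed without deciding
  -- incidence: any set S of indices of points on L has at most n elements.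
  record ProjectiveArc (k n : ℕ) : Set (lsuc (c ⊔ ℓ)) where
    field
      point    : Fin k → Point
      distinct : ∀ {i j} → point i ≈ₚ point j → i ≡ j
      meets≤   : ∀ (L : Line) (S : Subset k) → (∀ {i} → i ∈ S → point i on L) → ∣ S ∣ ≤ n

  -- IsLargestArc n m says that m is the number mₙ(R).
  IsLargestArc : (n m : ℕ) → Set (lsuc (c ⊔ ℓ))
  IsLargestArc n m = ProjectiveArc m n × (∀ k → ProjectiveArc k n → k ≤ m)

{-# OPTIONS --safe #-}

-- Write q = 2h and s = q - 1.  Counting the incidences of an arc of size (q⁴ - q)/2 along the lines
-- through one of its points bounds each neighbour class by h s points; since the classes add up to the
-- size of the arc, all of them have exactly h s points and every line meets the arc in 0 or q²/2 points.
-- Hence there are q² + q + 1 passants (lines missing the arc), an odd number, and every point is on 0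
-- or 2 of them.  But R contains 𝔽_q, so the plane contains a copy of PG(2,q), and a line α + βX meets
-- it in the points p with α·p = 0 and β·σ(p) = 0, which are 1 or q + 1 in number, hence an odd number.
-- Counting the incidences of the passants with this subplane in two ways gives both parities.

module Submission where

open import Defs
open import Algebra.Bundles using (CommutativeRing; RawRing; Ring)
open import Algebra.Module.Bundles using (RightModule)
open import Algebra.Morphism.Structures using (module RingMorphisms; IsRingMonomorphism)
import Algebra.Morphism.RingMonomorphism as RingMonomorphism
import Algebra.Properties.AbelianGroup as AbelianGroupProperties
import Algebra.Properties.CommutativeSemigroup as CommutativeSemigroupProperties
import Algebra.Properties.Ring as RingProperties
import Algebra.Solver.Ring.NaturalCoefficients.Default as SemiringSolver
open import Algebra.Structures using (IsCommutativeRing)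
open import Data.Bool.Base using (Bool; true; false; if_then_else_; _∧_)
open import Data.Empty using (⊥; ⊥-elim)
open import Data.Fin.Base using (Fin; zero; suc; _↑ˡ_)
import Data.Fin.Properties as Fin
open import Data.Fin.Subset using (Subset; ∣_∣) renaming (_∈_ to _∈ˢ_)
open import Data.List.Base as List using (List; []; _∷_; _++_; length; allFin; cartesianProduct; cartesianProductWith)
open import Data.List.Membership.Propositional using (_∈_)
open import Data.List.Membership.Propositional.Properties using (∈-cartesianProduct⁺; ∈-allFin)
open import Data.List.Properties using (map-tabulate; length-tabulate)
open import Data.List.Relation.Unary.Any using (here; there)
open import Data.Nat using (ℕ; zero; suc; _≤_; _<_; _^_; _∸_; z≤n; s≤s; NonZero; >-nonZero; _≤?_)
open import Data.Nat using () renaming (_+_ to _+ℕ_; _*_ to _*ℕ_; _≟_ to _≟ℕ_)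
open import Data.Nat.DivMod using (_/_; m*n/n≡m)
open import Data.Nat.Divisibility using (_∣_; _∣0; divides; ∣m∣n⇒∣m+n; ∣m+n∣m⇒∣n; ∣m⇒∣m*n; ∣n⇒∣m*n; m∣m*n; ∣1⇒≡1)
open import Data.Nat.Properties using (≤-refl; ≤-trans; ≤-reflexive; ≰⇒>; m+[n∸m]≡n; m+n∸n≡m; *-distribˡ-+)
open import Data.Nat.Tactic.RingSolver using (solve-∀)
open import Data.Product using (Σ; ∃; _×_; _,_; proj₁; proj₂)
open import Data.Sum.Base using (_⊎_; inj₁; inj₂)
open import Data.Vec.Base as Vec using (Vec; []; _∷_; head; tail; zipWith; replicate)
import Data.Vec.Properties as Vec
open import Function.Base using (_∘_; id)
open import Function.Bundles using (Inverse)
open import Level using (Level; _⊔_; 0ℓ)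
open import Relation.Binary.Definitions using (DecidableEquality)
open import Relation.Binary.PropositionalEquality as ≡ using (_≡_; _≢_)
import Relation.Binary.Reasoning.Setoid as SetoidReasoning
open import Relation.Nullary using (¬_; Dec; yes; no; does; ¬?; _×-dec_)

-- The numbers come from one identity. Let `u` be the number of arc points in the class of a point,
-- and let `e` be 1 if the point is in the arc and 0 if not. The multiplicities of the lines through
-- the point then add up to `k + s u + q² e`, because two distinct neighbours share `q = 1 + s`
-- lines and a point shares all its `q + q²` lines with itself. For `u = h s` and `e = 1` this is
-- exactly `q (q + 1) n` with `n = h q`, so the pencil is full. For `e = 0` the deficit is
-- `q² = 2 n`, hence two passants. All counts run over vectors, so parity has to survive the
-- multiplicities. A line has `q s` rows; the even factor `q` is removed by normalising rows, which
-- leaves the odd factor `s`. In the subplane the zero vector is kept: a line contains `q` or `q²`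
-- of the vectors, both even, while zero satisfies every row. The term of the zero vector is
-- therefore the odd number of all normalised passants, and all other terms and the total are even.

module _ where

  open import Data.Nat using (_+_; _*_)
  open import Data.Nat.Properties hiding (_≟_)
  open ≡

  -- Finite sums

  private variable
    A B C : Set
    P Q : Set

  𝟙 : Dec P → ℕ
  𝟙 d = if does d then 1 else 0

  𝟙-yes : (d : Dec P) → P → 𝟙 d ≡ 1
  𝟙-yes (yes _) _ = refl
  𝟙-yes (no ¬p) p = ⊥-elim (¬p p)

  𝟙-no : (d : Dec P) → ¬ P → 𝟙 d ≡ 0
  𝟙-no (yes p) ¬p = ⊥-elim (¬p p)
  𝟙-no (no _)  _  = refl

  𝟙-positive : (d : Dec P) → 0 < 𝟙 d → P
  𝟙-positive (yes p) _ = p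

  𝟙-cong : (d : Dec P) (e : Dec Q) → (P → Q) → (Q → P) → 𝟙 d ≡ 𝟙 e
  𝟙-cong (yes p) e to from = sym (𝟙-yes e (to p))
  𝟙-cong (no ¬p) e to from = sym (𝟙-no e (¬p ∘ from))

  𝟙-*-cong : (d : Dec P) {m n : ℕ} → (P → m ≡ n) → 𝟙 d * m ≡ 𝟙 d * n
  𝟙-*-cong (yes p) eq = cong (1 *_) (eq p)
  𝟙-*-cong (no _)  _  = refl

  ∑ : List A → (A → ℕ) → ℕ
  ∑ []       f = 0
  ∑ (x ∷ xs) f = f x + ∑ xs f

  ∑-cong : (xs : List A) {f g : A → ℕ} → (∀ x → f x ≡ g x) → ∑ xs f ≡ ∑ xs g
  ∑-cong []       eq = refl
  ∑-cong (x ∷ xs) eq = cong₂ _+_ (eq x) (∑-cong xs eq)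

  ∑-mono : (xs : List A) {f g : A → ℕ} → (∀ x → f x ≤ g x) → ∑ xs f ≤ ∑ xs g
  ∑-mono []       le = z≤n
  ∑-mono (x ∷ xs) le = +-mono-≤ (le x) (∑-mono xs le)

  ∑-+ : (xs : List A) (f g : A → ℕ) → ∑ xs (λ x → f x + g x) ≡ ∑ xs f + ∑ xs g
  ∑-+ []       f g = refl
  ∑-+ (x ∷ xs) f g = trans (cong (f x + g x +_) (∑-+ xs f g)) (interchange (f x) (g x) _ _)
    where
    interchange : ∀ a b c d → (a + b) + (c + d) ≡ (a + c) + (b + d)
    interchange = solve-∀

  ∑-*ˡ : (xs : List A) (c : ℕ) (f : A → ℕ) → ∑ xs (λ x → c * f x) ≡ c * ∑ xs f
  ∑-*ˡ []       c f = sym (*-zeroʳ c)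
  ∑-*ˡ (x ∷ xs) c f = trans (cong (c * f x +_) (∑-*ˡ xs c f)) (sym (*-distribˡ-+ c (f x) _))

  ∑-*ʳ : (xs : List A) (c : ℕ) (f : A → ℕ) → ∑ xs (λ x → f x * c) ≡ ∑ xs f * c
  ∑-*ʳ xs c f = trans (∑-cong xs (λ x → *-comm (f x) c)) (trans (∑-*ˡ xs c f) (*-comm c _))

  ∑-const : (xs : List A) (c : ℕ) → ∑ xs (λ _ → c) ≡ length xs * c
  ∑-const []       c = refl
  ∑-const (x ∷ xs) c = cong (c +_) (∑-const xs c)

  ∑-swap : (xs : List A) (ys : List B) (f : A → B → ℕ) →
           ∑ xs (λ x → ∑ ys (f x)) ≡ ∑ ys (λ y → ∑ xs (λ x → f x y))
  ∑-swap []       ys f = sym (trans (∑-const ys 0) (*-zeroʳ (length ys)))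
  ∑-swap (x ∷ xs) ys f = trans (cong (∑ ys (f x) +_) (∑-swap xs ys f))
                               (sym (∑-+ ys (f x) (λ y → ∑ xs (λ x → f x y))))

  ∑-++ : (xs ys : List A) (f : A → ℕ) → ∑ (xs ++ ys) f ≡ ∑ xs f + ∑ ys f
  ∑-++ []       ys f = refl
  ∑-++ (x ∷ xs) ys f = trans (cong (f x +_) (∑-++ xs ys f)) (sym (+-assoc (f x) _ _))

  ∑-map : (g : A → B) (xs : List A) (f : B → ℕ) → ∑ (List.map g xs) f ≡ ∑ xs (f ∘ g)
  ∑-map g []       f = refl
  ∑-map g (x ∷ xs) f = cong (f (g x) +_) (∑-map g xs f)

  ∑-cartesianProductWith : (g : A → B → C) (xs : List A) (ys : List B) (f : C → ℕ) →
    ∑ (cartesianProductWith g xs ys) f ≡ ∑ xs (λ x → ∑ ys (λ y → f (g x y)))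
  ∑-cartesianProductWith g []       ys f = refl
  ∑-cartesianProductWith g (x ∷ xs) ys f = trans (∑-++ (List.map (g x) ys) _ f)
    (cong₂ _+_ (∑-map (g x) ys f) (∑-cartesianProductWith g xs ys f))

  ∑-∣ : {d : ℕ} (xs : List A) {f : A → ℕ} → (∀ x → d ∣ f x) → d ∣ ∑ xs f
  ∑-∣ {d = d} [] _ = d ∣0
  ∑-∣ (x ∷ xs) div = ∣m∣n⇒∣m+n (div x) (∑-∣ xs div)

  ∑-positive : (xs : List A) {f : A → ℕ} → 0 < ∑ xs f → ∃ λ x → x ∈ xs × 0 < f x
  ∑-positive (x ∷ xs) {f} pos with f x in eq
  ... | suc _ = x , here refl , ≤-trans (s≤s z≤n) (≤-reflexive (sym eq))
  ... | zero  with ∑-positive xs pos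
  ...   | y , y∈ , pos′ = y , there y∈ , pos′

  ∑-term : {xs : List A} (f : A → ℕ) {x : A} → x ∈ xs → f x ≤ ∑ xs f
  ∑-term f (here refl) = m≤m+n _ _
  ∑-term {xs = y ∷ _} f (there x∈) = ≤-trans (∑-term f x∈) (m≤n+m _ (f y))

  -- The total leaves no slack for a strict inequality in any term. This turns the two extremal
  -- bounds, on classes and on lines, into equalities.
  ∑-tight : {xs : List A} {f g : A → ℕ} → (∀ x → f x ≤ g x) → ∑ xs g ≤ ∑ xs f →
            ∀ {x} → x ∈ xs → f x ≡ g x
  ∑-tight {xs = y ∷ xs} {f} {g} le sum≤ (here refl) = ≤-antisym (le y)
    (+-cancelʳ-≤ (∑ xs g) (g y) (f y) (≤-trans sum≤ (+-monoʳ-≤ (f y) (∑-mono xs le))))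
  ∑-tight {xs = y ∷ xs} {f} {g} le sum≤ (there x∈) = ∑-tight le
    (+-cancelˡ-≤ (g y) (∑ xs g) (∑ xs f) (≤-trans sum≤ (+-monoˡ-≤ (∑ xs f) (le y)))) x∈

  ∑-allFin-suc : (n : ℕ) (f : Fin (suc n) → ℕ) →
                 ∑ (allFin (suc n)) f ≡ f zero + ∑ (allFin n) (f ∘ suc)
  ∑-allFin-suc n f = cong (f zero +_)
    (trans (cong (λ xs → ∑ xs f) (sym (map-tabulate id suc))) (∑-map suc (allFin n) f))

  -- Serves to pass from a larger arc to its first points.
  ∑-allFin-↑ˡ : (m n : ℕ) (f : Fin (m + n) → ℕ) →
                ∑ (allFin m) (λ i → f (i ↑ˡ n)) ≤ ∑ (allFin (m + n)) f
  ∑-allFin-↑ˡ zero    n f = z≤n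
  ∑-allFin-↑ˡ (suc m) n f = subst₂ _≤_
    (sym (∑-allFin-suc m (λ i → f (i ↑ˡ n)))) (sym (∑-allFin-suc (m + n) f))
    (+-monoʳ-≤ (f zero) (∑-allFin-↑ˡ m n (f ∘ suc)))

  -- Completeness and absence of repetitions are one equation, `once`, in the form in which sums
  -- consume it: an indicator collapses a sum to a single term.
  record Finite (A : Set) : Set where
    infix 4 _≟_
    field
      elements : List A
      _≟_      : DecidableEquality A
      once     : ∀ a → ∑ elements (λ x → 𝟙 (x ≟ a)) ≡ 1

    ∈-elements : ∀ a → a ∈ elements
    ∈-elements a with ∑-positive elements (≤-reflexive (sym (once a)))
    ... | x , x∈ , pos = subst (_∈ elements) (𝟙-positive (x ≟ a) pos) x∈

    ∑-δ : ∀ a (f : A → ℕ) → ∑ elements (λ x → 𝟙 (x ≟ a) * f x) ≡ f a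
    ∑-δ a f = begin
      ∑ elements (λ x → 𝟙 (x ≟ a) * f x)  ≡⟨ ∑-cong elements (λ x → 𝟙-*-cong (x ≟ a) (cong f)) ⟩
      ∑ elements (λ x → 𝟙 (x ≟ a) * f a)  ≡⟨ ∑-*ʳ elements (f a) _ ⟩
      ∑ elements (λ x → 𝟙 (x ≟ a)) * f a  ≡⟨ cong (_* f a) (once a) ⟩
      1 * f a                             ≡⟨ *-identityˡ (f a) ⟩
      f a                                 ∎
      where open ≡-Reasoning

    ∑-≢ : ∀ a (f : A → ℕ) → ∑ elements (λ x → 𝟙 (¬? (x ≟ a)) * f x) + f a ≡ ∑ elements f
    ∑-≢ a f = begin
      ∑ elements (λ x → 𝟙 (¬? (x ≟ a)) * f x) + f a
        ≡⟨ cong (∑ elements (λ x → 𝟙 (¬? (x ≟ a)) * f x) +_) (∑-δ a f) ⟨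
      ∑ elements (λ x → 𝟙 (¬? (x ≟ a)) * f x) + ∑ elements (λ x → 𝟙 (x ≟ a) * f x)
        ≡⟨ ∑-+ elements _ _ ⟨
      ∑ elements (λ x → 𝟙 (¬? (x ≟ a)) * f x + 𝟙 (x ≟ a) * f x)
        ≡⟨ ∑-cong elements (λ x → split (x ≟ a) (f x)) ⟩
      ∑ elements f ∎
      where
      open ≡-Reasoning
      split : (d : Dec P) (n : ℕ) → 𝟙 (¬? d) * n + 𝟙 d * n ≡ n
      split (yes _) n = *-identityˡ n
      split (no _)  n = trans (+-identityʳ (1 * n)) (*-identityˡ n)

    -- Double counting over the graph of `π`: insert the indicator of `y ≡ π x`, exchange the sums,
    -- and read the same condition as `x ≡ π⁻¹ y`.
    ∑-reindex : (π π⁻¹ : A → A) → (∀ x → π⁻¹ (π x) ≡ x) → (∀ x → π (π⁻¹ x) ≡ x) →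
                (f : A → ℕ) → ∑ elements (f ∘ π) ≡ ∑ elements f
    ∑-reindex π π⁻¹ left right f = begin
      ∑ elements (f ∘ π)
        ≡⟨ ∑-cong elements (λ x → ∑-δ (π x) f) ⟨
      ∑ elements (λ x → ∑ elements (λ y → 𝟙 (y ≟ π x) * f y))
        ≡⟨ ∑-swap elements elements _ ⟩
      ∑ elements (λ y → ∑ elements (λ x → 𝟙 (y ≟ π x) * f y))
        ≡⟨ ∑-cong elements (λ y → trans (∑-cong elements (λ x → cong (_* f y)
             (𝟙-cong (y ≟ π x) (x ≟ π⁻¹ y)
                (λ { refl → sym (left x) }) (λ { refl → sym (right y) }))))
             (∑-δ (π⁻¹ y) (λ _ → f y))) ⟩
      ∑ elements f ∎
      where open ≡-Reasoning

  finite-Fin : (n : ℕ) → Finite (Fin n)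
  finite-Fin n = record { elements = allFin n ; _≟_ = Fin._≟_ ; once = once n }
    where
    once : ∀ n (a : Fin n) → ∑ (allFin n) (λ x → 𝟙 (x Fin.≟ a)) ≡ 1
    once (suc n) zero    = trans (∑-allFin-suc n (λ x → 𝟙 (x Fin.≟ zero)))
      (cong suc (trans (∑-cong (allFin n) (λ x → 𝟙-no (suc x Fin.≟ zero) λ ()))
                       (trans (∑-const (allFin n) 0) (*-zeroʳ (length (allFin n))))))
    once (suc n) (suc a) = trans (∑-allFin-suc n (λ x → 𝟙 (x Fin.≟ suc a)))
      (trans (∑-cong (allFin n) (λ x → 𝟙-cong (suc x Fin.≟ suc a) (x Fin.≟ a) Fin.suc-injective (cong suc)))
             (once n a))

  -- Vectors over a finite set

  module _ (F : Finite A) where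
    open Finite F

    vectors : (n : ℕ) → List (Vec A n)
    vectors zero    = [] ∷ []
    vectors (suc n) = cartesianProductWith _∷_ elements (vectors n)

    ∑-vectors-suc : (n : ℕ) (f : Vec A (suc n) → ℕ) →
                    ∑ (vectors (suc n)) f ≡ ∑ elements (λ x → ∑ (vectors n) (λ v → f (x ∷ v)))
    ∑-vectors-suc n f = ∑-cartesianProductWith _∷_ elements (vectors n) f

    length-vectors : (n : ℕ) → length (vectors n) ≡ length elements ^ n
    length-vectors n = trans (sym (trans (∑-const (vectors n) 1) (*-identityʳ _))) (go n)
      where
      go : ∀ n → ∑ (vectors n) (λ _ → 1) ≡ length elements ^ n
      go zero    = refl
      go (suc n) = trans (∑-vectors-suc n (λ _ → 1))
        (trans (∑-cong elements (λ _ → go n)) (∑-const elements (length elements ^ n)))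

    finite-Vec : (n : ℕ) → Finite (Vec A n)
    finite-Vec n = record { elements = vectors n ; _≟_ = Vec.≡-dec _≟_ ; once = once′ n }
      where
      once′ : ∀ n (a : Vec A n) → ∑ (vectors n) (λ x → 𝟙 (Vec.≡-dec _≟_ x a)) ≡ 1
      once′ zero    []      = refl
      once′ (suc n) (a ∷ v) = begin
        ∑ (vectors (suc n)) (λ x → 𝟙 (Vec.≡-dec _≟_ x (a ∷ v)))
          ≡⟨ ∑-vectors-suc n _ ⟩
        ∑ elements (λ x → ∑ (vectors n) (λ w → 𝟙 (Vec.≡-dec _≟_ (x ∷ w) (a ∷ v))))
          ≡⟨ ∑-cong elements (λ x → ∑-cong (vectors n) (λ w → 𝟙-∷ x w)) ⟩
        ∑ elements (λ x → ∑ (vectors n) (λ w → 𝟙 (x ≟ a) * 𝟙 (Vec.≡-dec _≟_ w v)))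
          ≡⟨ ∑-cong elements (λ x → trans (∑-*ˡ (vectors n) (𝟙 (x ≟ a)) _) (cong (𝟙 (x ≟ a) *_) (once′ n v))) ⟩
        ∑ elements (λ x → 𝟙 (x ≟ a) * 1)
          ≡⟨ ∑-δ a (λ _ → 1) ⟩
        1 ∎
        where
        open ≡-Reasoning
        𝟙-∷ : ∀ x w → 𝟙 (Vec.≡-dec _≟_ (x ∷ w) (a ∷ v)) ≡ 𝟙 (x ≟ a) * 𝟙 (Vec.≡-dec _≟_ w v)
        𝟙-∷ x w with x ≟ a | Vec.≡-dec _≟_ w v
        ... | yes refl | yes refl = refl
        ... | yes refl | no _     = refl
        ... | no _     | _        = refl

  -- Linear algebra over a finite field

  record FiniteField (K : Set) : Set where
    infixl 6 _⊕_
    infixl 7 _⊗_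
    infix  8 ⊝_
    field
      _⊕_ _⊗_           : K → K → K
      ⊝_                : K → K
      0ᴷ 1ᴷ             : K
      isCommutativeRing : IsCommutativeRing _≡_ _⊕_ _⊗_ ⊝_ 0ᴷ 1ᴷ
      1≢0               : 1ᴷ ≢ 0ᴷ
      inverse           : ∀ x → x ≢ 0ᴷ → ∃ λ y → x ⊗ y ≡ 1ᴷ
      finite            : Finite K

  record Automorphism {K : Set} (F : FiniteField K) : Set where
    open FiniteField F
    field
      σ σ⁻¹ : K → K
      σ-⊕   : ∀ x y → σ (x ⊕ y) ≡ σ x ⊕ σ y
      σ-⊗   : ∀ x y → σ (x ⊗ y) ≡ σ x ⊗ σ y
      σ-0   : σ 0ᴷ ≡ 0ᴷ
      σ-1   : σ 1ᴷ ≡ 1ᴷ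
      σσ⁻¹  : ∀ x → σ (σ⁻¹ x) ≡ x

  module LinearAlgebra {K : Set} (F : FiniteField K) where
    open FiniteField F
    open Finite finite using (elements; _≟_)

    commutativeRing : CommutativeRing 0ℓ 0ℓ
    commutativeRing = record { isCommutativeRing = isCommutativeRing }

    open CommutativeRing commutativeRing using (commutativeSemiring)
    open CommutativeRing commutativeRing public using ()
      renaming ( +-identityˡ to ⊕-identityˡ; +-identityʳ to ⊕-identityʳ; +-assoc to ⊕-assoc; +-comm to ⊕-comm
               ; -‿inverseˡ to ⊝-inverseˡ; -‿inverseʳ to ⊝-inverseʳ; zeroˡ to ⊗-zeroˡ; zeroʳ to ⊗-zeroʳ
               ; *-identityˡ to ⊗-identityˡ; *-identityʳ to ⊗-identityʳ; *-assoc to ⊗-assoc; *-comm to ⊗-comm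
               ; distribˡ to ⊗-distribˡ; distribʳ to ⊗-distribʳ )
    open SemiringSolver commutativeSemiring using (solve; _:+_; _:*_; _:=_)

    q : ℕ
    q = length elements

    V : ℕ → Set
    V = Vec K

    infixl 6 _⊞_
    infixr 9 _•_
    infix  8 _∙_

    _⊞_ : ∀ {n} → V n → V n → V n
    _⊞_ = zipWith _⊕_

    _•_ : ∀ {n} → K → V n → V n
    c • x = Vec.map (c ⊗_) x

    _∙_ : ∀ {n} → V n → V n → K
    []      ∙ []      = 0ᴷ
    (a ∷ x) ∙ (b ∷ y) = a ⊗ b ⊕ x ∙ y

    0ᵛ : ∀ {n} → V n
    0ᵛ {n} = replicate n 0ᴷ

    ∙-⊞ˡ : ∀ {n} (x y z : V n) → (x ⊞ y) ∙ z ≡ x ∙ z ⊕ y ∙ z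
    ∙-⊞ˡ []      []      []      = sym (⊕-identityʳ 0ᴷ)
    ∙-⊞ˡ (a ∷ x) (b ∷ y) (c ∷ z) = trans (cong ((a ⊕ b) ⊗ c ⊕_) (∙-⊞ˡ x y z))
      (solve 5 (λ a b c u v → (a :+ b) :* c :+ (u :+ v) := (a :* c :+ u) :+ (b :* c :+ v)) refl
        a b c (x ∙ z) (y ∙ z))

    ∙-comm : ∀ {n} (x y : V n) → x ∙ y ≡ y ∙ x
    ∙-comm []      []      = refl
    ∙-comm (a ∷ x) (b ∷ y) = cong₂ _⊕_ (⊗-comm a b) (∙-comm x y)

    ∙-⊞ʳ : ∀ {n} (x y z : V n) → x ∙ (y ⊞ z) ≡ x ∙ y ⊕ x ∙ z
    ∙-⊞ʳ x y z = trans (∙-comm x (y ⊞ z)) (trans (∙-⊞ˡ y z x) (cong₂ _⊕_ (∙-comm y x) (∙-comm z x)))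

    ∙-•ˡ : ∀ {n} c (x z : V n) → (c • x) ∙ z ≡ c ⊗ x ∙ z
    ∙-•ˡ c []      []      = sym (⊗-zeroʳ c)
    ∙-•ˡ c (a ∷ x) (b ∷ z) = trans (cong ((c ⊗ a) ⊗ b ⊕_) (∙-•ˡ c x z))
      (solve 4 (λ c a b u → (c :* a) :* b :+ c :* u := c :* (a :* b :+ u)) refl c a b (x ∙ z))

    ∙-•ʳ : ∀ {n} c (x z : V n) → x ∙ (c • z) ≡ c ⊗ x ∙ z
    ∙-•ʳ c x z = trans (∙-comm x (c • z)) (trans (∙-•ˡ c z x) (cong (c ⊗_) (∙-comm z x)))

    ∙-zeroˡ : ∀ {n} (x : V n) → 0ᵛ ∙ x ≡ 0ᴷ
    ∙-zeroˡ []      = refl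
    ∙-zeroˡ (a ∷ x) = trans (cong₂ _⊕_ (⊗-zeroˡ a) (∙-zeroˡ x)) (⊕-identityʳ 0ᴷ)

    ∙-zeroʳ : ∀ {n} (x : V n) → x ∙ 0ᵛ ≡ 0ᴷ
    ∙-zeroʳ x = trans (∙-comm x 0ᵛ) (∙-zeroˡ x)

    •-zeroˡ : ∀ {n} (x : V n) → 0ᴷ • x ≡ 0ᵛ
    •-zeroˡ []      = refl
    •-zeroˡ (a ∷ x) = cong₂ _∷_ (⊗-zeroˡ a) (•-zeroˡ x)

    •-identity : ∀ {n} (x : V n) → 1ᴷ • x ≡ x
    •-identity []      = refl
    •-identity (a ∷ x) = cong₂ _∷_ (⊗-identityˡ a) (•-identity x)

    •-assoc : ∀ {n} c d (x : V n) → c • d • x ≡ (c ⊗ d) • x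
    •-assoc c d []      = refl
    •-assoc c d (a ∷ x) = cong₂ _∷_ (sym (⊗-assoc c d a)) (•-assoc c d x)

    •-distribʳ : ∀ {n} c d (x : V n) → (c ⊕ d) • x ≡ c • x ⊞ d • x
    •-distribʳ c d []      = refl
    •-distribʳ c d (a ∷ x) = cong₂ _∷_ (⊗-distribʳ a c d) (•-distribʳ c d x)

    ⊞-identityʳ : ∀ {n} (x : V n) → x ⊞ 0ᵛ ≡ x
    ⊞-identityʳ []      = refl
    ⊞-identityʳ (a ∷ x) = cong₂ _∷_ (⊕-identityʳ a) (⊞-identityʳ x)

    ⊞-assoc : ∀ {n} (x y z : V n) → (x ⊞ y) ⊞ z ≡ x ⊞ (y ⊞ z)
    ⊞-assoc []      []      []      = refl
    ⊞-assoc (a ∷ x) (b ∷ y) (c ∷ z) = cong₂ _∷_ (⊕-assoc a b c) (⊞-assoc x y z)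

    translate : ∀ {n} {c d} → c ⊕ d ≡ 0ᴷ → (x t : V n) → (x ⊞ c • t) ⊞ d • t ≡ x
    translate {c = c} {d} eq x t = begin
      (x ⊞ c • t) ⊞ d • t  ≡⟨ ⊞-assoc x (c • t) (d • t) ⟩
      x ⊞ (c • t ⊞ d • t)  ≡⟨ cong (x ⊞_) (•-distribʳ c d t) ⟨
      x ⊞ (c ⊕ d) • t      ≡⟨ cong (λ e → x ⊞ e • t) eq ⟩
      x ⊞ 0ᴷ • t           ≡⟨ cong (x ⊞_) (•-zeroˡ t) ⟩
      x ⊞ 0ᵛ               ≡⟨ ⊞-identityʳ x ⟩
      x                    ∎
      where open ≡-Reasoning

    ≡⊝⇒⊕≡0 : ∀ {x y} → x ≡ ⊝ y → y ⊕ x ≡ 0ᴷ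
    ≡⊝⇒⊕≡0 {y = y} refl = ⊝-inverseʳ y

    ⊕≡0⇒≡⊝ : ∀ {x y} → y ⊕ x ≡ 0ᴷ → x ≡ ⊝ y
    ⊕≡0⇒≡⊝ {x} {y} eq = begin
      x              ≡⟨ ⊕-identityˡ x ⟨
      0ᴷ ⊕ x         ≡⟨ cong (_⊕ x) (⊝-inverseˡ y) ⟨
      (⊝ y ⊕ y) ⊕ x  ≡⟨ ⊕-assoc (⊝ y) y x ⟩
      ⊝ y ⊕ (y ⊕ x)  ≡⟨ cong (⊝ y ⊕_) eq ⟩
      ⊝ y ⊕ 0ᴷ       ≡⟨ ⊕-identityʳ (⊝ y) ⟩
      ⊝ y            ∎
      where open ≡-Reasoning

    functional : ∀ {n} (x : V n) → x ≢ 0ᵛ → ∃ λ e → e ∙ x ≡ 1ᴷ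
    functional []      x≢0 = ⊥-elim (x≢0 refl)
    functional (a ∷ x) x≢0 with a ≟ 0ᴷ
    ... | no a≢0 with inverse a a≢0
    ...   | b , ab = (b ∷ 0ᵛ) , trans (cong₂ _⊕_ (trans (⊗-comm b a) ab) (∙-zeroˡ x)) (⊕-identityʳ 1ᴷ)
    functional (a ∷ x) x≢0 | yes refl with functional x (λ x≡0 → x≢0 (cong (0ᴷ ∷_) x≡0))
    ...   | e , ex = (0ᴷ ∷ e) , trans (cong₂ _⊕_ (⊗-zeroˡ 0ᴷ) ex) (⊕-identityˡ 1ᴷ)

    infix 4 _∈⟨_⟩
    _∈⟨_⟩ : ∀ {n} → V n → V n → Set
    t ∈⟨ s ⟩ = ∃ λ c → t ≡ c • s

    -- A positive witness of independence from `s`. The functional `e` doubles as a direction of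
    -- translation that fixes the equation of `s` and moves the equation of `t`.
    Separated : ∀ {n} → V n → V n → Set
    Separated s t = ∃ λ e → e ∙ s ≡ 0ᴷ × e ∙ t ≡ 1ᴷ

    -- Gaussian elimination on the first coordinate. If it vanishes on `s`, either the tails decide
    -- or the first coordinate itself separates. Otherwise the multiple of `s` that clears the first
    -- coordinate of `t` is subtracted, and a nonzero remainder is detected by a functional.
    span-or-separated : ∀ {n} (s t : V n) → s ≢ 0ᵛ → t ∈⟨ s ⟩ ⊎ Separated s t
    span-or-separated []      []      s≢0 = ⊥-elim (s≢0 refl)
    span-or-separated (a ∷ s) (b ∷ t) s≢0 with a ≟ 0ᴷ
    span-or-separated (a ∷ s) (b ∷ t) s≢0 | yes refl
      with span-or-separated s t (λ s≡0 → s≢0 (cong (0ᴷ ∷_) s≡0))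
    ... | inj₂ (e , es , et) = inj₂ ((0ᴷ ∷ e)
          , trans (cong₂ _⊕_ (⊗-zeroˡ 0ᴷ) es) (⊕-identityʳ 0ᴷ)
          , trans (cong₂ _⊕_ (⊗-zeroˡ b) et) (⊕-identityˡ 1ᴷ))
    ... | inj₁ (c , refl) with b ≟ 0ᴷ
    ...   | yes refl = inj₁ (c , cong (_∷ c • s) (sym (⊗-zeroʳ c)))
    ...   | no b≢0 with inverse b b≢0
    ...     | b⁻¹ , bb⁻¹ = inj₂ ((b⁻¹ ∷ 0ᵛ)
            , trans (cong₂ _⊕_ (⊗-zeroʳ b⁻¹) (∙-zeroˡ s)) (⊕-identityʳ 0ᴷ)
            , trans (cong₂ _⊕_ (trans (⊗-comm b⁻¹ b) bb⁻¹) (∙-zeroˡ (c • s))) (⊕-identityʳ 1ᴷ))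
    span-or-separated {suc n} (a ∷ s) (b ∷ t) s≢0 | no a≢0 with inverse a a≢0
    ... | a⁻¹ , aa⁻¹ with Finite._≟_ (finite-Vec finite n) (t ⊞ (⊝ (b ⊗ a⁻¹)) • s) 0ᵛ
    ...   | yes t-cs≡0 = inj₁ (c , cong₂ _∷_ b≡ca t≡cs)
      where
      c = b ⊗ a⁻¹
      b≡ca : b ≡ c ⊗ a
      b≡ca = sym (trans (solve 3 (λ a b x → (b :* x) :* a := b :* (a :* x)) refl a b a⁻¹)
                        (trans (cong (b ⊗_) aa⁻¹) (⊗-identityʳ b)))
      ⊞-comm : ∀ {n} (x y : V n) → x ⊞ y ≡ y ⊞ x
      ⊞-comm []      []      = refl
      ⊞-comm (a ∷ x) (b ∷ y) = cong₂ _∷_ (⊕-comm a b) (⊞-comm x y)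
      t≡cs : t ≡ c • s
      t≡cs = trans (sym (translate (⊝-inverseˡ c) t s))
               (trans (cong (_⊞ c • s) t-cs≡0) (trans (⊞-comm 0ᵛ (c • s)) (⊞-identityʳ (c • s))))
    ...   | no t-cs≢0 with functional (t ⊞ (⊝ (b ⊗ a⁻¹)) • s) t-cs≢0
    -- The first entry is chosen so that the functional kills `s`; its value on `t` is then `e`
    -- applied to the remainder `t - c s`, which is 1.
    ...     | e , ew = inj₂ ((⊝ es ⊗ a⁻¹ ∷ e) , on-s , on-t)
      where
      c  = b ⊗ a⁻¹
      es = e ∙ s
      on-s : (⊝ es ⊗ a⁻¹) ⊗ a ⊕ es ≡ 0ᴷ
      on-s = trans (cong (_⊕ es)
          (trans (solve 3 (λ n x a → (n :* x) :* a := n :* (a :* x)) refl (⊝ es) a⁻¹ a)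
                 (trans (cong (⊝ es ⊗_) aa⁻¹) (⊗-identityʳ (⊝ es)))))
        (⊝-inverseˡ es)
      swap⊝ : ⊝ es ⊗ c ≡ ⊝ c ⊗ es
      swap⊝ = trans (⊕≡0⇒≡⊝ (trans (sym (⊗-distribʳ c es (⊝ es))) (trans (cong (_⊗ c) (⊝-inverseʳ es)) (⊗-zeroˡ c))))
        (sym (⊕≡0⇒≡⊝ (trans (cong (_⊕ ⊝ c ⊗ es) (⊗-comm es c))
          (trans (sym (⊗-distribʳ es c (⊝ c))) (trans (cong (_⊗ es) (⊝-inverseʳ c)) (⊗-zeroˡ es))))))
      on-t : (⊝ es ⊗ a⁻¹) ⊗ b ⊕ e ∙ t ≡ 1ᴷ
      on-t = begin
        (⊝ es ⊗ a⁻¹) ⊗ b ⊕ e ∙ t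
          ≡⟨ solve 4 (λ n x b u → (n :* x) :* b :+ u := u :+ n :* (b :* x)) refl (⊝ es) a⁻¹ b (e ∙ t) ⟩
        e ∙ t ⊕ ⊝ es ⊗ c               ≡⟨ cong (e ∙ t ⊕_) swap⊝ ⟩
        e ∙ t ⊕ ⊝ c ⊗ es               ≡⟨ cong (e ∙ t ⊕_) (∙-•ʳ (⊝ c) e s) ⟨
        e ∙ t ⊕ e ∙ ((⊝ c) • s)        ≡⟨ ∙-⊞ʳ e t ((⊝ c) • s) ⟨
        e ∙ (t ⊞ (⊝ c) • s)            ≡⟨ ew ⟩
        1ᴷ                             ∎
        where open ≡-Reasoning

    separated⇒∉span : ∀ {n} {s t : V n} → Separated s t → ¬ t ∈⟨ s ⟩
    separated⇒∉span {s = s} (e , es , et) (c , refl) = 1≢0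
      (trans (sym et) (trans (∙-•ʳ c e s) (trans (cong (c ⊗_) es) (⊗-zeroʳ c))))

    span? : ∀ {n} (s t : V n) → s ≢ 0ᵛ → Dec (t ∈⟨ s ⟩)
    span? s t s≢0 with span-or-separated s t s≢0
    ... | inj₁ t∈ = yes t∈
    ... | inj₂ sep = no (separated⇒∉span sep)

    -- Counting solutions of linear equations

    module Counting (n : ℕ) where
      open Finite (finite-Vec finite n) public
        using (∑-δ; ∑-≢; ∑-reindex; ∈-elements) renaming (elements to vecs; _≟_ to _≟ᵛ_)

      -- Both sides add up f x over the pairs (d , x) with φ (x ⊞ d • t) ≡ 0.
      slice : (t : V n) (φ : V n → K) (f : V n → ℕ) →
              (∀ d x → φ (x ⊞ d • t) ≡ φ x ⊕ d) → (∀ d x → f (x ⊞ d • t) ≡ f x) →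
              ∑ vecs f ≡ q * ∑ vecs (λ x → 𝟙 (φ x ≟ 0ᴷ) * f x)
      slice t φ f φ-shift f-shift = begin
        ∑ vecs f
          ≡⟨ ∑-cong vecs (λ x → Finite.∑-δ finite (⊝ φ x) (λ _ → f x)) ⟨
        ∑ vecs (λ x → ∑ elements (λ d → 𝟙 (d ≟ (⊝ φ x)) * f x))
          ≡⟨ ∑-swap vecs elements _ ⟩
        ∑ elements (λ d → ∑ vecs (λ x → 𝟙 (d ≟ (⊝ φ x)) * f x))
          ≡⟨ ∑-cong elements (λ d → ∑-cong vecs (λ x → cong₂ _*_
               (𝟙-cong (d ≟ (⊝ φ x)) (φ (x ⊞ d • t) ≟ 0ᴷ)
                 (λ eq → trans (φ-shift d x) (≡⊝⇒⊕≡0 eq))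
                 (λ eq → ⊕≡0⇒≡⊝ (trans (sym (φ-shift d x)) eq)))
               (sym (f-shift d x)))) ⟩
        ∑ elements (λ d → ∑ vecs (λ x → 𝟙 (φ (x ⊞ d • t) ≟ 0ᴷ) * f (x ⊞ d • t)))
          ≡⟨ ∑-cong elements (λ d → ∑-reindex (_⊞ d • t) (_⊞ (⊝ d) • t)
               (λ x → translate (⊝-inverseʳ d) x t) (λ x → translate (⊝-inverseˡ d) x t)
               (λ x → 𝟙 (φ x ≟ 0ᴷ) * f x)) ⟩
        ∑ elements (λ _ → ∑ vecs (λ x → 𝟙 (φ x ≟ 0ᴷ) * f x))
          ≡⟨ ∑-const elements _ ⟩
        q * ∑ vecs (λ x → 𝟙 (φ x ≟ 0ᴷ) * f x) ∎
        where open ≡-Reasoning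

      ∑1 : ∑ vecs (λ _ → 1) ≡ q ^ n
      ∑1 = trans (∑-const vecs 1) (trans (*-identityʳ _) (length-vectors finite n))

      affine-shift : ∀ {t s : V n} (c : K) → t ∙ s ≡ 1ᴷ → ∀ d x →
                     (x ⊞ d • t) ∙ s ⊕ c ≡ (x ∙ s ⊕ c) ⊕ d
      affine-shift {t} {s} c ts d x = begin
        (x ⊞ d • t) ∙ s ⊕ c            ≡⟨ cong (_⊕ c) (∙-⊞ˡ x (d • t) s) ⟩
        (x ∙ s ⊕ (d • t) ∙ s) ⊕ c      ≡⟨ cong (λ y → (x ∙ s ⊕ y) ⊕ c) (trans (∙-•ˡ d t s) (trans (cong (d ⊗_) ts) (⊗-identityʳ d))) ⟩
        (x ∙ s ⊕ d) ⊕ c                ≡⟨ solve 3 (λ u d c → (u :+ d) :+ c := (u :+ c) :+ d) refl (x ∙ s) d c ⟩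
        (x ∙ s ⊕ c) ⊕ d                ∎
        where open ≡-Reasoning

      affine-fixed : ∀ {t s : V n} (c : K) → t ∙ s ≡ 0ᴷ → ∀ d x →
                     (x ⊞ d • t) ∙ s ⊕ c ≡ x ∙ s ⊕ c
      affine-fixed {t} {s} c ts d x = cong (_⊕ c) (trans (∙-⊞ˡ x (d • t) s)
        (trans (cong (x ∙ s ⊕_) (trans (∙-•ˡ d t s) (trans (cong (d ⊗_) ts) (⊗-zeroʳ d)))) (⊕-identityʳ (x ∙ s))))

      -- Along a direction `t` with `t ∙ s ≡ 1` the affine form takes every value once, so `slice`
      -- applies with constant weight. The factor `q` stays on the left to avoid division;
      -- `plane-size` cancels it.
      hyperplane : (s : V n) (c : K) → s ≢ 0ᵛ → q * ∑ vecs (λ x → 𝟙 (x ∙ s ⊕ c ≟ 0ᴷ)) ≡ q ^ n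
      hyperplane s c s≢0 with functional s s≢0
      ... | t , ts = trans (cong (q *_) (∑-cong vecs (λ x → sym (*-identityʳ _))))
        (trans (sym (slice t (λ x → x ∙ s ⊕ c) (λ _ → 1) (affine-shift c ts) (λ _ _ → refl))) ∑1)

      -- The separating functional is a direction along which the first equation is constant and the
      -- second takes every value once.
      hyperplanes : (s t : V n) (c d : K) → s ≢ 0ᵛ → Separated s t →
                    q * (q * ∑ vecs (λ x → 𝟙 (x ∙ s ⊕ c ≟ 0ᴷ) * 𝟙 (x ∙ t ⊕ d ≟ 0ᴷ))) ≡ q ^ n
      hyperplanes s t c d s≢0 (e , es , et) = trans (cong (q *_) (sym (trans
          (slice e (λ x → x ∙ t ⊕ d) (λ x → 𝟙 (x ∙ s ⊕ c ≟ 0ᴷ)) (affine-shift d et)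
            (λ k x → cong (λ y → 𝟙 (y ≟ 0ᴷ)) (affine-fixed c es k x)))
          (cong (q *_) (∑-cong vecs (λ x → *-comm (𝟙 (x ∙ t ⊕ d ≟ 0ᴷ)) _))))))
        (hyperplane s c s≢0)

      -- The span is invariant under translation by `s` and meets the kernel of a functional with
      -- value 1 on `s` only in zero.
      span-size : (s : V n) (s≢0 : s ≢ 0ᵛ) → ∑ vecs (λ x → 𝟙 (span? s x s≢0)) ≡ q
      span-size s s≢0 with functional s s≢0
      ... | e , es = begin
        ∑ vecs (λ x → 𝟙 (span? s x s≢0))
          ≡⟨ slice s (λ x → x ∙ e) _ shift
               (λ d x → 𝟙-cong (span? s (x ⊞ d • s) s≢0) (span? s x s≢0)
                 (λ { (c , eq) → c ⊕ ⊝ d , trans (sym (translate (⊝-inverseʳ d) x s))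
                     (trans (cong (_⊞ (⊝ d) • s) eq) (sym (•-distribʳ c (⊝ d) s))) })
                 (λ { (c , refl) → c ⊕ d , sym (•-distribʳ c d s) })) ⟩
        q * ∑ vecs (λ x → 𝟙 (x ∙ e ≟ 0ᴷ) * 𝟙 (span? s x s≢0))
          ≡⟨ cong (q *_) (∑-cong vecs only-zero) ⟩
        q * ∑ vecs (λ x → 𝟙 (x ≟ᵛ 0ᵛ) * 1)
          ≡⟨ cong (q *_) (∑-δ 0ᵛ (λ _ → 1)) ⟩
        q * 1
          ≡⟨ *-identityʳ q ⟩
        q ∎
        where
        open ≡-Reasoning
        se : s ∙ e ≡ 1ᴷ
        se = trans (∙-comm s e) es
        shift : ∀ d x → (x ⊞ d • s) ∙ e ≡ x ∙ e ⊕ d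
        shift d x = trans (sym (⊕-identityʳ _)) (trans (affine-shift 0ᴷ se d x) (cong (_⊕ d) (⊕-identityʳ _)))
        only-zero : ∀ x → 𝟙 (x ∙ e ≟ 0ᴷ) * 𝟙 (span? s x s≢0) ≡ 𝟙 (x ≟ᵛ 0ᵛ) * 1
        only-zero x with x ∙ e ≟ 0ᴷ | span? s x s≢0 | x ≟ᵛ 0ᵛ
        ... | no xe  | _ | no _     = refl
        ... | no xe  | _ | yes refl = ⊥-elim (xe (∙-zeroˡ e))
        ... | yes xe | yes _ | yes _ = refl
        ... | yes xe | no ∉ | yes refl = ⊥-elim (∉ (0ᴷ , sym (•-zeroˡ s)))
        ... | yes xe | no _ | no _ = refl
        ... | yes xe | yes (c , refl) | no x≢0 = ⊥-elim (x≢0 (trans (cong (_• s) c≡0) (•-zeroˡ s)))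
          where
          c≡0 : c ≡ 0ᴷ
          c≡0 = trans (sym (trans (∙-•ˡ c s e) (trans (cong (c ⊗_) se) (⊗-identityʳ c)))) xe

  -- Counting lines

  module Plane {K : Set} (F : FiniteField K) (τ : Automorphism F) where

    open FiniteField F
    open Automorphism τ
    open LinearAlgebra F
    open Finite finite using (_≟_)
    open Counting 3

    σᵛ : ∀ {n} → V n → V n
    σᵛ = Vec.map σ

    σ-reflects-0 : ∀ x → σ x ≡ 0ᴷ → x ≡ 0ᴷ
    σ-reflects-0 x σx≡0 with x ≟ 0ᴷ
    ... | yes x≡0 = x≡0
    ... | no x≢0 with inverse x x≢0
    ...   | y , xy = ⊥-elim (1≢0 (begin
      1ᴷ         ≡⟨ σ-1 ⟨
      σ 1ᴷ       ≡⟨ cong σ xy ⟨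
      σ (x ⊗ y)  ≡⟨ σ-⊗ x y ⟩
      σ x ⊗ σ y  ≡⟨ cong (_⊗ σ y) σx≡0 ⟩
      0ᴷ ⊗ σ y   ≡⟨ ⊗-zeroˡ (σ y) ⟩
      0ᴷ         ∎))
      where open ≡-Reasoning

    σᵛ-reflects-0 : ∀ {n} (x : V n) → σᵛ x ≡ 0ᵛ → x ≡ 0ᵛ
    σᵛ-reflects-0 []      _  = refl
    σᵛ-reflects-0 (a ∷ x) eq = cong₂ _∷_ (σ-reflects-0 a (cong head eq))
                                         (σᵛ-reflects-0 x (cong tail eq))

    σᵛ-≢0 : ∀ {n} {x : V n} → x ≢ 0ᵛ → σᵛ x ≢ 0ᵛ
    σᵛ-≢0 {x = x} x≢0 eq = x≢0 (σᵛ-reflects-0 x eq)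

    σ-∙ : ∀ {n} (x y : V n) → σ (x ∙ y) ≡ σᵛ x ∙ σᵛ y
    σ-∙ []      []      = σ-0
    σ-∙ (a ∷ x) (b ∷ y) = trans (σ-⊕ (a ⊗ b) (x ∙ y)) (cong₂ _⊕_ (σ-⊗ a b) (σ-∙ x y))

    σᵛ-• : ∀ {n} c (x : V n) → σᵛ (c • x) ≡ σ c • σᵛ x
    σᵛ-• c []      = refl
    σᵛ-• c (a ∷ x) = cong₂ _∷_ (σ-⊗ c a) (σᵛ-• c x)

    σᵛ-surjective : ∀ {n} (x : V n) → σᵛ (Vec.map σ⁻¹ x) ≡ x
    σᵛ-surjective []      = refl
    σᵛ-surjective (a ∷ x) = cong₂ _∷_ (σσ⁻¹ a) (σᵛ-surjective x)

    σᵛ-separated : ∀ {n} {s t : V n} → Separated s t → Separated (σᵛ s) (σᵛ t)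
    σᵛ-separated {s = s} {t} (e , es , et) = σᵛ e
      , trans (sym (σ-∙ e s)) (trans (cong σ es) σ-0)
      , trans (sym (σ-∙ e t)) (trans (cong σ et) σ-1)

    -- (a , b) stands for the vector a + bX, a column for points and a row for lines.  Points and lines
    -- are not normalised: a line is the kernel of each of the q (q - 1) unit multiples of a row.
    R³ : Set
    R³ = V 3 × V 3

    pairs : List R³
    pairs = cartesianProduct vecs vecs

    nz : V 3 → ℕ
    nz α = 𝟙 (¬? (α ≟ᵛ 0ᵛ))

    on-residue : V 3 → V 3 → ℕ
    on-residue α a = 𝟙 (α ∙ a ≟ 0ᴷ)

    -- (α + βX)(a + bX) = αa + (α b + β σ(a)) X
    on-radical : R³ → R³ → ℕ
    on-radical (α , β) (a , b) = 𝟙 (β ∙ σᵛ a ⊕ α ∙ b ≟ 0ᴷ)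

    inc : R³ → R³ → ℕ
    inc (α , β) (a , b) = on-residue α a * on-radical (α , β) (a , b)

    inc-1 : ∀ ℓ v → proj₁ ℓ ∙ proj₁ v ≡ 0ᴷ → proj₂ ℓ ∙ σᵛ (proj₁ v) ⊕ proj₁ ℓ ∙ proj₂ v ≡ 0ᴷ → inc ℓ v ≡ 1
    inc-1 (α , β) (a , b) p r = cong₂ _*_ (𝟙-yes (α ∙ a ≟ 0ᴷ) p) (𝟙-yes (β ∙ σᵛ a ⊕ α ∙ b ≟ 0ᴷ) r)

    ∑-lines : (f : V 3 → ℕ) (g : V 3 → V 3 → ℕ) {c : ℕ} → (∀ α → ∑ vecs (g α) ≡ c) →
              ∑ pairs (λ ℓ → f (proj₁ ℓ) * g (proj₁ ℓ) (proj₂ ℓ)) ≡ ∑ vecs f * c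
    ∑-lines f g {c} eq = begin
      ∑ pairs (λ ℓ → f (proj₁ ℓ) * g (proj₁ ℓ) (proj₂ ℓ))
        ≡⟨ ∑-cartesianProductWith _,_ vecs vecs _ ⟩
      ∑ vecs (λ α → ∑ vecs (λ β → f α * g α β))
        ≡⟨ ∑-cong vecs (λ α → trans (∑-*ˡ vecs (f α) (g α)) (cong (f α *_) (eq α))) ⟩
      ∑ vecs (λ α → f α * c)
        ≡⟨ ∑-*ʳ vecs c f ⟩
      ∑ vecs f * c ∎
      where open ≡-Reasoning

    module _ (s : ℕ) (q≡ : q ≡ suc s) where

      private instance
        q-nonZero : NonZero q
        q-nonZero = subst NonZero (sym q≡) _

      plane-size : (a : V 3) (c : K) → a ≢ 0ᵛ → ∑ vecs (λ x → 𝟙 (x ∙ a ⊕ c ≟ 0ᴷ)) ≡ q * q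
      plane-size a c a≢0 = *-cancelˡ-≡ _ _ q (trans (hyperplane a c a≢0) (cong (λ y → q * (q * y)) (*-identityʳ q)))

      axis-size : (a a′ : V 3) (c c′ : K) → a ≢ 0ᵛ → Separated a a′ →
                  ∑ vecs (λ x → 𝟙 (x ∙ a ⊕ c ≟ 0ᴷ) * 𝟙 (x ∙ a′ ⊕ c′ ≟ 0ᴷ)) ≡ q
      axis-size a a′ c c′ a≢0 sep = *-cancelˡ-≡ _ _ q (*-cancelˡ-≡ _ _ q
        (trans (hyperplanes a a′ c c′ a≢0 sep) (cong (λ y → q * (q * y)) (*-identityʳ q))))

      𝟙-⊕0 : ∀ x → 𝟙 (x ⊕ 0ᴷ ≟ 0ᴷ) ≡ 𝟙 (x ≟ 0ᴷ)
      𝟙-⊕0 x = cong (λ y → 𝟙 (y ≟ 0ᴷ)) (⊕-identityʳ x)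

      -- Of the `q²` solutions zero is dropped, and `q² - 1 = s (1 + q)`: the `q + 1` lines through
      -- a point of the residue plane, with `s` rows each.
      residue-lines : (a : V 3) → a ≢ 0ᵛ → ∑ vecs (λ α → nz α * on-residue α a) ≡ s * (1 + q)
      residue-lines a a≢0 = +-cancelʳ-≡ 1 _ _ (begin
        ∑ vecs (λ α → nz α * on-residue α a) + 1
          ≡⟨ cong (∑ vecs (λ α → nz α * on-residue α a) +_) (𝟙-yes (0ᵛ ∙ a ≟ 0ᴷ) (∙-zeroˡ a)) ⟨
        ∑ vecs (λ α → nz α * on-residue α a) + on-residue 0ᵛ a
          ≡⟨ ∑-≢ 0ᵛ (λ α → on-residue α a) ⟩
        ∑ vecs (λ α → on-residue α a)
          ≡⟨ ∑-cong vecs (λ α → 𝟙-⊕0 (α ∙ a)) ⟨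
        ∑ vecs (λ α → 𝟙 (α ∙ a ⊕ 0ᴷ ≟ 0ᴷ))
          ≡⟨ plane-size a 0ᴷ a≢0 ⟩
        q * q
          ≡⟨ cong (λ q → q * q) q≡ ⟩
        suc s * suc s
          ≡⟨ arith s ⟩
        s * (1 + suc s) + 1
          ≡⟨ cong (λ q → s * (1 + q) + 1) q≡ ⟨
        s * (1 + q) + 1 ∎)
        where
        open ≡-Reasoning
        arith : ∀ s → suc s * suc s ≡ s * (1 + suc s) + 1
        arith = solve-∀

      residue-line : (a a′ : V 3) → a ≢ 0ᵛ → Separated a a′ →
                     ∑ vecs (λ α → nz α * (on-residue α a * on-residue α a′)) ≡ s
      residue-line a a′ a≢0 sep = +-cancelʳ-≡ 1 _ _ (begin
        ∑ vecs (λ α → nz α * (on-residue α a * on-residue α a′)) + 1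
          ≡⟨ cong (∑ vecs (λ α → nz α * (on-residue α a * on-residue α a′)) +_)
               (cong₂ _*_ (𝟙-yes (0ᵛ ∙ a ≟ 0ᴷ) (∙-zeroˡ a)) (𝟙-yes (0ᵛ ∙ a′ ≟ 0ᴷ) (∙-zeroˡ a′))) ⟨
        ∑ vecs (λ α → nz α * (on-residue α a * on-residue α a′)) + on-residue 0ᵛ a * on-residue 0ᵛ a′
          ≡⟨ ∑-≢ 0ᵛ (λ α → on-residue α a * on-residue α a′) ⟩
        ∑ vecs (λ α → on-residue α a * on-residue α a′)
          ≡⟨ ∑-cong vecs (λ α → cong₂ _*_ (𝟙-⊕0 (α ∙ a)) (𝟙-⊕0 (α ∙ a′))) ⟨
        ∑ vecs (λ α → 𝟙 (α ∙ a ⊕ 0ᴷ ≟ 0ᴷ) * 𝟙 (α ∙ a′ ⊕ 0ᴷ ≟ 0ᴷ))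
          ≡⟨ axis-size a a′ 0ᴷ 0ᴷ a≢0 sep ⟩
        q
          ≡⟨ trans q≡ (+-comm 1 s) ⟩
        s + 1 ∎)
        where open ≡-Reasoning

      -- These are the `q (q + 1)` lines through a point with `q s` rows each. For each residue `α`
      -- on `a`, the condition on `β` is one affine equation with nonzero coefficient vector `σᵛ a`.
      lines-through : (v : R³) → proj₁ v ≢ 0ᵛ →
                      ∑ pairs (λ ℓ → nz (proj₁ ℓ) * inc ℓ v) ≡ s * (1 + q) * (q * q)
      lines-through (a , b) a≢0 = begin
        ∑ pairs (λ ℓ → nz (proj₁ ℓ) * inc ℓ (a , b))
          ≡⟨ ∑-cong pairs (λ ℓ → sym (*-assoc (nz (proj₁ ℓ)) (on-residue (proj₁ ℓ) a) _)) ⟩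
        ∑ pairs (λ ℓ → nz (proj₁ ℓ) * on-residue (proj₁ ℓ) a * on-radical ℓ (a , b))
          ≡⟨ ∑-lines (λ α → nz α * on-residue α a) (λ α β → on-radical (α , β) (a , b))
               (λ α → plane-size (σᵛ a) (α ∙ b) (σᵛ-≢0 a≢0)) ⟩
        ∑ vecs (λ α → nz α * on-residue α a) * (q * q)
          ≡⟨ cong (_* (q * q)) (residue-lines a a≢0) ⟩
        s * (1 + q) * (q * q) ∎
        where open ≡-Reasoning

      -- Since `(a + bX)c = ca + σ(c)bX`, the second vector minus `c` times the first is
      -- `(b′ - σ(c)b)X`. On a row through the first vector, incidence with the second thus becomes
      -- a condition on the residue `α` alone.
      inc-neighbour : ∀ ℓ a b c b′ →
        inc ℓ (a , b) * inc ℓ (c • a , b′)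
        ≡ (on-residue (proj₁ ℓ) a * on-residue (proj₁ ℓ) (b′ ⊞ (⊝ σ c) • b)) * on-radical ℓ (a , b)
      inc-neighbour (α , β) a b c b′ with α ∙ a ≟ 0ᴷ | β ∙ σᵛ a ⊕ α ∙ b ≟ 0ᴷ
      ... | no _  | _    = refl
      ... | yes p | no _ = sym (*-zeroʳ (on-residue α (b′ ⊞ (⊝ σ c) • b) + 0))
      ... | yes p | yes r = trans (+-identityʳ _) (trans
            (cong (_* on-radical (α , β) (c • a , b′)) (𝟙-yes (α ∙ (c • a) ≟ 0ᴷ)
              (trans (∙-•ʳ c α a) (trans (cong (c ⊗_) p) (⊗-zeroʳ c)))))
            (trans (+-identityʳ _) (trans (cong (λ x → 𝟙 (x ≟ 0ᴷ)) same)
              (sym (trans (*-identityʳ _) (+-identityʳ _))))))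
        where
        open ≡-Reasoning
        u = β ∙ σᵛ a
        w = α ∙ b
        u≡⊝w : σ c ⊗ u ≡ ⊝ σ c ⊗ w
        u≡⊝w = begin
          σ c ⊗ u                          ≡⟨ ⊕-identityʳ _ ⟨
          σ c ⊗ u ⊕ 0ᴷ                     ≡⟨ cong (σ c ⊗ u ⊕_) (trans (cong (_⊗ w) (⊝-inverseʳ (σ c))) (⊗-zeroˡ w)) ⟨
          σ c ⊗ u ⊕ (σ c ⊕ ⊝ σ c) ⊗ w      ≡⟨ cong (σ c ⊗ u ⊕_) (⊗-distribʳ w (σ c) (⊝ σ c)) ⟩
          σ c ⊗ u ⊕ (σ c ⊗ w ⊕ ⊝ σ c ⊗ w)  ≡⟨ ⊕-assoc _ _ _ ⟨
          (σ c ⊗ u ⊕ σ c ⊗ w) ⊕ ⊝ σ c ⊗ w  ≡⟨ cong (_⊕ ⊝ σ c ⊗ w) (trans (sym (⊗-distribˡ (σ c) u w)) (trans (cong (σ c ⊗_) r) (⊗-zeroʳ (σ c)))) ⟩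
          0ᴷ ⊕ ⊝ σ c ⊗ w                   ≡⟨ ⊕-identityˡ _ ⟩
          ⊝ σ c ⊗ w                        ∎
        same : β ∙ σᵛ (c • a) ⊕ α ∙ b′ ≡ α ∙ (b′ ⊞ (⊝ σ c) • b)
        same = begin
          β ∙ σᵛ (c • a) ⊕ α ∙ b′        ≡⟨ cong (λ x → β ∙ x ⊕ α ∙ b′) (σᵛ-• c a) ⟩
          β ∙ (σ c • σᵛ a) ⊕ α ∙ b′      ≡⟨ cong (_⊕ α ∙ b′) (trans (∙-•ʳ (σ c) β (σᵛ a)) u≡⊝w) ⟩
          ⊝ σ c ⊗ w ⊕ α ∙ b′             ≡⟨ ⊕-comm _ _ ⟩
          α ∙ b′ ⊕ ⊝ σ c ⊗ w             ≡⟨ cong (α ∙ b′ ⊕_) (∙-•ʳ (⊝ σ c) α b) ⟨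
          α ∙ b′ ⊕ α ∙ ((⊝ σ c) • b)     ≡⟨ ∙-⊞ʳ α b′ ((⊝ σ c) • b) ⟨
          α ∙ (b′ ⊞ (⊝ σ c) • b)         ∎

      -- The number e is 1 if v and w span the same point and 0 otherwise.
      lines-joining : (v w : R³) (a≢0 : proj₁ v ≢ 0ᵛ) → ∃ λ e →
        ∑ pairs (λ ℓ → nz (proj₁ ℓ) * (inc ℓ v * inc ℓ w))
        ≡ q * s * (1 + s * 𝟙 (span? (proj₁ v) (proj₁ w) a≢0) + q * q * e)
      lines-joining v@(a , b) w@(a′ , b′) a≢0 with span-or-separated a a′ a≢0
      ... | inj₂ sep = 0 , (begin
        ∑ pairs (λ ℓ → nz (proj₁ ℓ) * (inc ℓ v * inc ℓ w))
          ≡⟨ ∑-cong pairs (λ ℓ → regroup (nz (proj₁ ℓ)) (on-residue (proj₁ ℓ) a) (on-radical ℓ v)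
                                         (on-residue (proj₁ ℓ) a′) (on-radical ℓ w)) ⟩
        ∑ pairs (λ ℓ → nz (proj₁ ℓ) * (on-residue (proj₁ ℓ) a * on-residue (proj₁ ℓ) a′)
                       * (on-radical ℓ v * on-radical ℓ w))
          ≡⟨ ∑-lines (λ α → nz α * (on-residue α a * on-residue α a′))
               (λ α β → on-radical (α , β) v * on-radical (α , β) w)
               (λ α → axis-size (σᵛ a) (σᵛ a′) (α ∙ b) (α ∙ b′) (σᵛ-≢0 a≢0) (σᵛ-separated sep)) ⟩
        ∑ vecs (λ α → nz α * (on-residue α a * on-residue α a′)) * q
          ≡⟨ cong (_* q) (residue-line a a′ a≢0 sep) ⟩
        s * q
          ≡⟨ arith s q ⟩
        q * s * (1 + s * 0 + q * q * 0) ∎)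
        where
        open ≡-Reasoning
        regroup : ∀ n x y x′ y′ → n * ((x * y) * (x′ * y′)) ≡ n * (x * x′) * (y * y′)
        regroup = solve-∀
        arith : ∀ s q → s * q ≡ q * s * (1 + s * 0 + q * q * 0)
        arith = solve-∀
      ... | inj₁ (c , refl) = joined
        where
        open ≡-Reasoning
        -- The vectors span the same point when this is a multiple of `a`: then the extra condition
        -- on `α` is vacuous and all `q + q²` lines remain. Otherwise it halves nothing but fixes
        -- the residue line, leaving `q = 1 + s` lines.
        b″ = b′ ⊞ (⊝ σ c) • b

        reduce : ∑ pairs (λ ℓ → nz (proj₁ ℓ) * (inc ℓ v * inc ℓ (c • a , b′)))
                 ≡ ∑ vecs (λ α → nz α * (on-residue α a * on-residue α b″)) * (q * q)
        reduce = begin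
          ∑ pairs (λ ℓ → nz (proj₁ ℓ) * (inc ℓ v * inc ℓ (c • a , b′)))
            ≡⟨ ∑-cong pairs (λ ℓ → trans (cong (nz (proj₁ ℓ) *_) (inc-neighbour ℓ a b c b′))
                 (sym (*-assoc (nz (proj₁ ℓ)) _ (on-radical ℓ v)))) ⟩
          ∑ pairs (λ ℓ → nz (proj₁ ℓ) * (on-residue (proj₁ ℓ) a * on-residue (proj₁ ℓ) b″) * on-radical ℓ v)
            ≡⟨ ∑-lines (λ α → nz α * (on-residue α a * on-residue α b″)) (λ α β → on-radical (α , β) v)
                 (λ α → plane-size (σᵛ a) (α ∙ b) (σᵛ-≢0 a≢0)) ⟩
          ∑ vecs (λ α → nz α * (on-residue α a * on-residue α b″)) * (q * q) ∎

        joined : ∃ λ e → ∑ pairs (λ ℓ → nz (proj₁ ℓ) * (inc ℓ v * inc ℓ (c • a , b′)))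
                         ≡ q * s * (1 + s * 1 + q * q * e)
        joined with span-or-separated a b″ a≢0
        ... | inj₂ sep = 0 , trans reduce (trans (cong (_* (q * q)) (residue-line a b″ a≢0 sep))
                (trans (cong (λ y → s * (y * q)) q≡)
                  (trans (arith s q) (cong (λ y → q * s * y) (cong (1 + s * 1 +_) (sym (*-zeroʳ (q * q))))))))
          where
          arith : ∀ s q → s * (suc s * q) ≡ q * s * (1 + s * 1 + 0)
          arith = solve-∀
        ... | inj₁ (d , b″≡) = 1 , (begin
          ∑ pairs (λ ℓ → nz (proj₁ ℓ) * (inc ℓ v * inc ℓ (c • a , b′)))
            ≡⟨ reduce ⟩
          ∑ vecs (λ α → nz α * (on-residue α a * on-residue α b″)) * (q * q)
            ≡⟨ cong (_* (q * q)) (∑-cong vecs (λ α → cong (nz α *_) (absorb α))) ⟩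
          ∑ vecs (λ α → nz α * on-residue α a) * (q * q)
            ≡⟨ cong (_* (q * q)) (residue-lines a a≢0) ⟩
          s * (1 + q) * (q * q)
            ≡⟨ arith₁ s q ⟩
          q * s * (q + q * q * 1)
            ≡⟨ cong (λ y → q * s * (y + q * q * 1)) (trans q≡ (cong suc (sym (*-identityʳ s)))) ⟩
          q * s * (1 + s * 1 + q * q * 1) ∎)
          where
          arith₁ : ∀ s q → s * (1 + q) * (q * q) ≡ q * s * (q + q * q * 1)
          arith₁ = solve-∀
          absorb : ∀ α → on-residue α a * on-residue α b″ ≡ on-residue α a
          absorb α = trans (𝟙-*-cong (α ∙ a ≟ 0ᴷ) (λ p → 𝟙-yes (α ∙ b″ ≟ 0ᴷ)
              (trans (cong (α ∙_) b″≡) (trans (∙-•ʳ d α a) (trans (cong (d ⊗_) p) (⊗-zeroʳ d))))))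
            (*-identityʳ _)

      -- The radical part changes by `d σ(α ∙ a)`, which vanishes on rows whose residue is incident
      -- with `a`.
      inc-shift : ∀ α β d v → inc (α , β ⊞ d • σᵛ α) v ≡ inc (α , β) v
      inc-shift α β d (a , b) = 𝟙-*-cong (α ∙ a ≟ 0ᴷ) λ p → cong (λ x → 𝟙 (x ≟ 0ᴷ))
        (affine-fixed (α ∙ b) (trans (sym (σ-∙ α a)) (trans (cong σ p) σ-0)) d β)

      -- With `γ = σ⁻¹(β)` the semilinear condition `β ∙ σ(p) = 0` becomes the linear one
      -- `p ∙ γ = 0`. The solutions form a space of `q` or `q²` vectors, according to whether `γ`
      -- lies in the span of `α`. Counting zero as well is what makes the number even.
      subplane-even : ∀ α β → α ≢ 0ᵛ → 2 ∣ q → 2 ∣ ∑ vecs (λ p → inc (α , β) (p , 0ᵛ))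
      subplane-even α β α≢0 2∣q with span-or-separated α (Vec.map σ⁻¹ β) α≢0
        | ∑-cong vecs linear
        where
        γ = Vec.map σ⁻¹ β
        radical : ∀ p → β ∙ σᵛ p ⊕ α ∙ 0ᵛ ≡ σ (p ∙ γ)
        radical p = begin
          β ∙ σᵛ p ⊕ α ∙ 0ᵛ  ≡⟨ cong (β ∙ σᵛ p ⊕_) (∙-zeroʳ α) ⟩
          β ∙ σᵛ p ⊕ 0ᴷ      ≡⟨ ⊕-identityʳ _ ⟩
          β ∙ σᵛ p           ≡⟨ ∙-comm β (σᵛ p) ⟩
          σᵛ p ∙ β           ≡⟨ cong (σᵛ p ∙_) (σᵛ-surjective β) ⟨
          σᵛ p ∙ σᵛ γ        ≡⟨ σ-∙ p γ ⟨
          σ (p ∙ γ)          ∎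
          where open ≡-Reasoning
        linear : ∀ p → inc (α , β) (p , 0ᵛ) ≡ 𝟙 (p ∙ α ⊕ 0ᴷ ≟ 0ᴷ) * 𝟙 (p ∙ γ ⊕ 0ᴷ ≟ 0ᴷ)
        linear p = cong₂ _*_
          (cong (λ x → 𝟙 (x ≟ 0ᴷ)) (trans (∙-comm α p) (sym (⊕-identityʳ _))))
          (𝟙-cong (β ∙ σᵛ p ⊕ α ∙ 0ᵛ ≟ 0ᴷ) (p ∙ γ ⊕ 0ᴷ ≟ 0ᴷ)
            (λ eq → trans (⊕-identityʳ _) (σ-reflects-0 (p ∙ γ) (trans (sym (radical p)) eq)))
            (λ eq → trans (radical p) (trans (cong σ (trans (sym (⊕-identityʳ _)) eq)) σ-0)))
      ... | inj₂ sep | eq = subst (2 ∣_) (sym (trans eq (axis-size α (Vec.map σ⁻¹ β) 0ᴷ 0ᴷ α≢0 sep))) 2∣q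
      ... | inj₁ (c , γ≡cα) | eq = subst (2 ∣_)
              (sym (trans eq (trans (∑-cong vecs absorb) (plane-size α 0ᴷ α≢0)))) (∣m⇒∣m*n q 2∣q)
        where
        absorb : ∀ p → 𝟙 (p ∙ α ⊕ 0ᴷ ≟ 0ᴷ) * 𝟙 (p ∙ Vec.map σ⁻¹ β ⊕ 0ᴷ ≟ 0ᴷ) ≡ 𝟙 (p ∙ α ⊕ 0ᴷ ≟ 0ᴷ)
        absorb p = trans (𝟙-*-cong (p ∙ α ⊕ 0ᴷ ≟ 0ᴷ) (λ pα → 𝟙-yes (p ∙ Vec.map σ⁻¹ β ⊕ 0ᴷ ≟ 0ᴷ)
            (trans (⊕-identityʳ _) (trans (cong (p ∙_) γ≡cα) (trans (∙-•ʳ c p α)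
              (trans (cong (c ⊗_) (trans (sym (⊕-identityʳ _)) pα)) (⊗-zeroʳ c)))))))
          (*-identityʳ _)

      -- The rows (α , β ⊞ d • σᵛ α) = (1 + dX)(α , β) describe the same line; transversal α picks
      -- one row out of these q.  This leaves q - 1 rows per line, an odd number.
      transversal : V 3 → V 3
      transversal α with α ≟ᵛ 0ᵛ
      ... | yes _  = 0ᵛ
      ... | no α≢0 = proj₁ (functional (σᵛ α) (σᵛ-≢0 α≢0))

      transversal-∙ : ∀ α → α ≢ 0ᵛ → σᵛ α ∙ transversal α ≡ 1ᴷ
      transversal-∙ α α≢0 with α ≟ᵛ 0ᵛ
      ... | yes α≡0 = ⊥-elim (α≢0 α≡0)
      ... | no α≢0′ = trans (∙-comm (σᵛ α) _) (proj₂ (functional (σᵛ α) (σᵛ-≢0 α≢0′)))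

      -- As `σᵛ α` has value 1 on the transversal, every coset of its span contains exactly one `β`
      -- of value 0. The summand `0ᴷ` gives the form that `affine-shift` expects.
      normal : R³ → ℕ
      normal (α , β) = 𝟙 (β ∙ transversal α ⊕ 0ᴷ ≟ 0ᴷ)

      ∑-normal : (f : R³ → ℕ) → (∀ α β d → f (α , β ⊞ d • σᵛ α) ≡ f (α , β)) →
                 ∑ pairs (λ ℓ → nz (proj₁ ℓ) * f ℓ) ≡ q * ∑ pairs (λ ℓ → nz (proj₁ ℓ) * (normal ℓ * f ℓ))
      ∑-normal f f-shift = begin
        ∑ pairs (λ ℓ → nz (proj₁ ℓ) * f ℓ)
          ≡⟨ ∑-cartesianProductWith _,_ vecs vecs _ ⟩
        ∑ vecs (λ α → ∑ vecs (λ β → nz α * f (α , β)))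
          ≡⟨ ∑-cong vecs (λ α → trans (∑-*ˡ vecs (nz α) _) (trans
               (𝟙-*-cong (¬? (α ≟ᵛ 0ᵛ)) (λ α≢0 →
                 slice (σᵛ α) (λ β → β ∙ transversal α ⊕ 0ᴷ) (λ β → f (α , β))
                   (affine-shift 0ᴷ (transversal-∙ α α≢0)) (λ d β → f-shift α β d)))
               (trans (commute (nz α) q _) (cong (q *_) (sym (∑-*ˡ vecs (nz α) _)))))) ⟩
        ∑ vecs (λ α → q * ∑ vecs (λ β → nz α * (normal (α , β) * f (α , β))))
          ≡⟨ ∑-*ˡ vecs q _ ⟩
        q * ∑ vecs (λ α → ∑ vecs (λ β → nz α * (normal (α , β) * f (α , β))))
          ≡⟨ cong (q *_) (∑-cartesianProductWith _,_ vecs vecs _) ⟨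
        q * ∑ pairs (λ ℓ → nz (proj₁ ℓ) * (normal ℓ * f ℓ)) ∎
        where
        open ≡-Reasoning
        commute : ∀ a b c → a * (b * c) ≡ b * (a * c)
        commute = solve-∀

  -- With q = 2 h and s = q - 1 the arc has (q⁴ - q) / 2 = h s (q² + q + 1) points, at most
  -- q² / 2 = h q of them on a line, and h s of them in every neighbour class.
  module Parameters (g : ℕ) where

    h s q₀ : ℕ
    h  = suc g
    s  = suc (2 * g)
    q₀ = suc s

    module _ {q : ℕ} (q≡ : q ≡ q₀) where

      -- In lines: a point lies on `q + q²` of them, two distinct neighbours share only `q`. It
      -- shows that a point joined to itself has a nonzero `e`.
      through-≢-joining : s * (1 + q) * (q * q) ≢ q * s * (1 + s * 1 + q * q * 0)
      through-≢-joining eq rewrite q≡ = 1+n≢0 (+-cancelˡ-≡ q₀ (q₀ * q₀) 0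
        (*-cancelˡ-≡ (q₀ + q₀ * q₀) (q₀ + 0) (q₀ * s) (trans (lhs s) (trans eq (rhs s)))))
        where
        lhs : ∀ s → (1 + s) * s * ((1 + s) + (1 + s) * (1 + s)) ≡ s * (1 + (1 + s)) * ((1 + s) * (1 + s))
        lhs = solve-∀
        rhs : ∀ s → (1 + s) * s * (1 + s * 1 + (1 + s) * (1 + s) * 0) ≡ (1 + s) * s * ((1 + s) + 0)
        rhs = solve-∀

      -- The point of equality of the whole argument, `k + s (h s) + q² = q (q + 1) n` in lines,
      -- with `q s` rows each. It holds because `q² = 2 h q`.
      full-pencil : q * s * (h * s * (q * q + q + 1) + s * (h * s) + q * q) ≡ s * (1 + q) * (q * q) * (h * q)
      full-pencil rewrite q≡ = expand g
        where
        expand : ∀ g → suc (suc (2 * g)) * suc (2 * g) * (suc g * suc (2 * g) * (suc (suc (2 * g)) * suc (suc (2 * g)) + suc (suc (2 * g)) + 1) + suc (2 * g) * (suc g * suc (2 * g)) + suc (suc (2 * g)) * suc (suc (2 * g)))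
          ≡ suc (2 * g) * (1 + suc (suc (2 * g))) * (suc (suc (2 * g)) * suc (suc (2 * g))) * (suc g * suc (suc (2 * g)))
        expand = solve-∀

      -- By `full-pencil`, `u = h s` and `e = 1` already exhaust all lines through the point, and a
      -- larger `e` only leaves less room for `u`.
      class-bound : ∀ {u e} → q * s * (h * s * (q * q + q + 1) + s * u + q * q * e) ≤ s * (1 + q) * (q * q) * (h * q) →
                    1 ≤ e → u ≤ h * s
      class-bound {u} {e} le 1≤e rewrite q≡ = *-cancelˡ-≤ s
        (+-cancelˡ-≤ k (s * u) (s * (h * s)) (+-cancelʳ-≤ (q₀ * q₀) (k + s * u) (k + s * (h * s))
          (*-cancelˡ-≤ (q₀ * s) (begin
            q₀ * s * (k + s * u + q₀ * q₀)           ≤⟨ *-monoʳ-≤ (q₀ * s) (+-monoʳ-≤ (k + s * u) (m≤m*n (q₀ * q₀) e ⦃ >-nonZero 1≤e ⦄)) ⟩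
            q₀ * s * (k + s * u + q₀ * q₀ * e)       ≤⟨ le ⟩
            s * (1 + q₀) * (q₀ * q₀) * (h * q₀)      ≡⟨ fp ⟨
            q₀ * s * (k + s * (h * s) + q₀ * q₀)     ∎))))
        where
        open ≤-Reasoning
        k = h * s * (q₀ * q₀ + q₀ + 1)
        fp = subst (λ q → q * s * (h * s * (q * q + q + 1) + s * (h * s) + q * q) ≡ s * (1 + q) * (q * q) * (h * q)) q≡ full-pencil

      -- The reverse of the inequality behind `class-bound`: once the class has `h s` points, the
      -- pencil of an arc point is full.
      pencil-tight : ∀ {e} → 1 ≤ e →
        s * (1 + q) * (q * q) * (h * q) ≤ q * s * (h * s * (q * q + q + 1) + s * (h * s) + q * q * e)
      pencil-tight {e} 1≤e = begin
        s * (1 + q) * (q * q) * (h * q)                                       ≡⟨ full-pencil ⟨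
        q * s * (h * s * (q * q + q + 1) + s * (h * s) + q * q)
          ≤⟨ *-monoʳ-≤ (q * s) (+-monoʳ-≤ (h * s * (q * q + q + 1) + s * (h * s)) (m≤m*n (q * q) e ⦃ >-nonZero 1≤e ⦄)) ⟩
        q * s * (h * s * (q * q + q + 1) + s * (h * s) + q * q * e) ∎
        where open ≤-Reasoning

      -- Compared with a full pencil the count lacks `q² (1 - e)` points per row multiplicity, and
      -- each passant lacks `h q`. As `q² = 2 h q`, there are `2 - 2 e` passants with `q s` rows
      -- each; the equation is arranged without subtraction.
      passants-through : ∀ {e z} →
        q * s * (h * s * (q * q + q + 1) + s * (h * s) + q * q * e) + h * q * z ≡ s * (1 + q) * (q * q) * (h * q) →
        z + q * (2 * (s * e)) ≡ q * (2 * s)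
      passants-through {e} {z} eq = *-cancelˡ-≡ _ _ (h * q) ⦃ m*n≢0 h q ⦄ (+-cancelˡ-≡ c _ _ (begin
        c + h * q * (z + q * (2 * (s * e)))      ≡⟨ expand h q s (h * s * (q * q + q + 1) + s * (h * s)) e z ⟩
        q * s * (h * s * (q * q + q + 1) + s * (h * s) + (2 * h) * q * e) + h * q * z
          ≡⟨ cong (λ x → q * s * (h * s * (q * q + q + 1) + s * (h * s) + x * q * e) + h * q * z) 2h≡q ⟩
        q * s * (h * s * (q * q + q + 1) + s * (h * s) + q * q * e) + h * q * z
          ≡⟨ eq ⟩
        s * (1 + q) * (q * q) * (h * q)
          ≡⟨ full-pencil ⟨
        q * s * (h * s * (q * q + q + 1) + s * (h * s) + q * q)
          ≡⟨ cong (λ x → q * s * (h * s * (q * q + q + 1) + s * (h * s) + x * q)) 2h≡q ⟨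
        q * s * (h * s * (q * q + q + 1) + s * (h * s) + (2 * h) * q)
          ≡⟨ expand′ h q s (h * s * (q * q + q + 1) + s * (h * s)) ⟨
        c + h * q * (q * (2 * s)) ∎))
        where
        open ≡-Reasoning
        instance
          q-nonZero : NonZero q
          q-nonZero = subst NonZero (sym q≡) _
        c = q * s * (h * s * (q * q + q + 1) + s * (h * s))
        2h≡q : 2 * h ≡ q
        2h≡q = trans (*-distribˡ-+ 2 1 g) (sym q≡)
        expand : ∀ h q s x e z → q * s * x + h * q * (z + q * (2 * (s * e)))
                                 ≡ q * s * (x + (2 * h) * q * e) + h * q * z
        expand = solve-∀
        expand′ : ∀ h q s x → q * s * x + h * q * (q * (2 * s)) ≡ q * s * (x + (2 * h) * q)
        expand′ = solve-∀

      -- All incidences: `q² (q² + q + 1)` lines of `h q` points would exceed `k` points on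
      -- `q (q + 1)` lines each by `h q` times `q² + q + 1`, because `q² - s (q + 1) = 1`. The
      -- number `w` is that of the nonzero residues.
      passants : ∀ {w z} → w + 1 ≡ q * (q * q) →
        h * s * (q * q + q + 1) * (s * (1 + q) * (q * q)) + h * q * z ≡ w * (q * (q * q)) * (h * q) →
        z ≡ q * (s * (q * q + q + 1))
      passants {w} {z} w≡ eq rewrite q≡ = *-cancelˡ-≡ _ _ (h * q₀) (+-cancelˡ-≡ c _ _
        (trans eq (trans (cong (λ w → w * (q₀ * (q₀ * q₀)) * (h * q₀)) w≡′) (expand h s))))
        where
        c = h * s * (q₀ * q₀ + q₀ + 1) * (s * (1 + q₀) * (q₀ * q₀))
        cube : ∀ s → (1 + s) * ((1 + s) * (1 + s)) ≡ s * ((1 + s) * (1 + s) + (1 + s) + 1) + 1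
        cube = solve-∀
        w≡′ : w ≡ s * (q₀ * q₀ + q₀ + 1)
        w≡′ = +-cancelʳ-≡ 1 _ _ (trans w≡ (cube s))
        expand : ∀ h s → s * ((1 + s) * (1 + s) + (1 + s) + 1) * ((1 + s) * ((1 + s) * (1 + s))) * (h * (1 + s))
          ≡ h * s * ((1 + s) * (1 + s) + (1 + s) + 1) * (s * (1 + (1 + s)) * ((1 + s) * (1 + s)))
            + h * (1 + s) * ((1 + s) * (s * ((1 + s) * (1 + s) + (1 + s) + 1)))
        expand = solve-∀

      passants-odd : ¬ 2 ∣ s * (q * q + q + 1)
      passants-odd d rewrite q≡ with ∣1⇒≡1 (∣m+n∣m⇒∣n (subst (2 ∣_) (expand g) d) (m∣m*n (3 + g * (12 + g * (12 + g * 4)))))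
        where
        expand : ∀ g → suc (2 * g) * (suc (suc (2 * g)) * suc (suc (2 * g)) + suc (suc (2 * g)) + 1)
                       ≡ 2 * (3 + g * (12 + g * (12 + g * 4))) + 1
        expand = solve-∀
      ... | ()

  -- Arcs of the extremal size

  module Arc {K : Set} (F : FiniteField K) (τ : Automorphism F)
    (g : ℕ) (q≡ : LinearAlgebra.q F ≡ Parameters.q₀ g)
    (k : ℕ)
    (point : Fin k → Vec K 3 × Vec K 3)
    (point≢0 : ∀ j → proj₁ (point j) ≢ LinearAlgebra.0ᵛ F) where

    open FiniteField F
    open Automorphism τ
    open LinearAlgebra F
    open Plane F τ
    open Parameters g
    open Counting 3

    private instance
      q-nonZero : NonZero q
      q-nonZero = subst NonZero (sym q≡) _

    multiplicity : R³ → ℕ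
    multiplicity ℓ = ∑ (allFin k) (λ j → inc ℓ (point j))

    class-size : V 3 → ℕ
    class-size a = ∑ (allFin k) (λ j → 𝟙 (span? (proj₁ (point j)) a (point≢0 j)))

    same-point : R³ → Fin k → ℕ
    same-point w j = proj₁ (lines-joining s q≡ (point j) w (point≢0 j))

    private
      E : R³ → ℕ
      E w = ∑ (allFin k) (same-point w)

    ∑-points-const : ∀ c → ∑ (allFin k) (λ _ → c) ≡ k * c
    ∑-points-const c = trans (∑-const (allFin k) c) (cong (_* c) (length-tabulate {n = k} id))

    -- Counts the pairs of an arc point and a row through it and `w`, grouped by the arc point;
    -- `E w` collects the arc points equal to `w`.
    pencil : ∀ w → ∑ pairs (λ ℓ → nz (proj₁ ℓ) * (inc ℓ w * multiplicity ℓ))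
                   ≡ q * s * (k + s * class-size (proj₁ w) + q * q * E w)
    pencil w = begin
      ∑ pairs (λ ℓ → nz (proj₁ ℓ) * (inc ℓ w * multiplicity ℓ))
        ≡⟨ ∑-cong pairs (λ ℓ → trans (cong (nz (proj₁ ℓ) *_) (trans (*-comm (inc ℓ w) _)
             (sym (∑-*ʳ (allFin k) (inc ℓ w) _)))) (sym (∑-*ˡ (allFin k) (nz (proj₁ ℓ)) _))) ⟩
      ∑ pairs (λ ℓ → ∑ (allFin k) (λ j → nz (proj₁ ℓ) * (inc ℓ (point j) * inc ℓ w)))
        ≡⟨ ∑-swap pairs (allFin k) _ ⟩
      ∑ (allFin k) (λ j → ∑ pairs (λ ℓ → nz (proj₁ ℓ) * (inc ℓ (point j) * inc ℓ w)))
        ≡⟨ ∑-cong (allFin k) (λ j → proj₂ (lines-joining s q≡ (point j) w (point≢0 j))) ⟩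
      ∑ (allFin k) (λ j → q * s * (1 + s * 𝟙 (span? (proj₁ (point j)) (proj₁ w) (point≢0 j)) + q * q * same-point w j))
        ≡⟨ ∑-*ˡ (allFin k) (q * s) _ ⟩
      q * s * ∑ (allFin k) (λ j → 1 + s * 𝟙 (span? (proj₁ (point j)) (proj₁ w) (point≢0 j)) + q * q * same-point w j)
        ≡⟨ cong (q * s *_) (trans (∑-+ (allFin k) _ _) (cong₂ _+_ (∑-+ (allFin k) _ _) refl)) ⟩
      q * s * (∑ (allFin k) (λ _ → 1) + ∑ (allFin k) (λ j → s * 𝟙 (span? (proj₁ (point j)) (proj₁ w) (point≢0 j)))
               + ∑ (allFin k) (λ j → q * q * same-point w j))
        ≡⟨ cong (q * s *_) (cong₂ _+_ (cong₂ _+_ (trans (∑-points-const 1) (*-identityʳ k))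
             (∑-*ˡ (allFin k) s _)) (∑-*ˡ (allFin k) (q * q) _)) ⟩
      q * s * (k + s * class-size (proj₁ w) + q * q * E w) ∎
      where open ≡-Reasoning

    inc-idem : ∀ ℓ v → inc ℓ v * inc ℓ v ≡ inc ℓ v
    inc-idem (α , β) (a , b) with Finite._≟_ finite (α ∙ a) 0ᴷ | Finite._≟_ finite (β ∙ σᵛ a ⊕ α ∙ b) 0ᴷ
    ... | yes _ | yes _ = refl
    ... | yes _ | no _  = refl
    ... | no _  | _     = refl

    -- `lines-joining` leaves its `e` existential. Joining the point to itself gives all rows
    -- through it, which excludes `e = 0`.
    same-point-positive : ∀ i → 1 ≤ E (point i)
    same-point-positive i = ≤-trans (positive refl) (∑-term (same-point (point i)) (∈-allFin i))
      where
      positive : ∀ {e} → e ≡ same-point (point i) i → 1 ≤ e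
      positive {suc e} _  = s≤s z≤n
      positive {zero}  eq = ⊥-elim (through-≢-joining q≡ (begin
        s * (1 + q) * (q * q)
          ≡⟨ lines-through s q≡ (point i) (point≢0 i) ⟨
        ∑ pairs (λ ℓ → nz (proj₁ ℓ) * inc ℓ (point i))
          ≡⟨ ∑-cong pairs (λ ℓ → cong (nz (proj₁ ℓ) *_) (inc-idem ℓ (point i))) ⟨
        ∑ pairs (λ ℓ → nz (proj₁ ℓ) * (inc ℓ (point i) * inc ℓ (point i)))
          ≡⟨ proj₂ (lines-joining s q≡ (point i) (point i) (point≢0 i)) ⟩
        q * s * (1 + s * 𝟙 (span? (proj₁ (point i)) (proj₁ (point i)) (point≢0 i)) + q * q * same-point (point i) i)
          ≡⟨ cong₂ (λ x e → q * s * (1 + s * x + q * q * e))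
               (𝟙-yes (span? (proj₁ (point i)) (proj₁ (point i)) (point≢0 i)) (1ᴷ , sym (•-identity _))) (sym eq) ⟩
        q * s * (1 + s * 1 + q * q * 0) ∎))
        where open ≡-Reasoning

    n : ℕ
    n = h * q

    ∑-lines-through-n : ∀ w → proj₁ w ≢ 0ᵛ →
      ∑ pairs (λ ℓ → nz (proj₁ ℓ) * (inc ℓ w * n)) ≡ s * (1 + q) * (q * q) * n
    ∑-lines-through-n w w≢0 = trans
      (∑-cong pairs (λ ℓ → sym (*-assoc (nz (proj₁ ℓ)) (inc ℓ w) n)))
      (trans (∑-*ʳ pairs n _) (cong (_* n) (lines-through s q≡ w w≢0)))

    module _ (k≡ : k ≡ h * s * (q * q + q + 1))
             (bound : ∀ ℓ → proj₁ ℓ ≢ 0ᵛ → multiplicity ℓ ≤ n) where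

      pencil-≤ : ∀ w ℓ → nz (proj₁ ℓ) * (inc ℓ w * multiplicity ℓ) ≤ nz (proj₁ ℓ) * (inc ℓ w * n)
      pencil-≤ w ℓ with proj₁ ℓ ≟ᵛ 0ᵛ
      ... | yes _  = z≤n
      ... | no ℓ≢0 = *-monoʳ-≤ 1 (*-monoʳ-≤ (inc ℓ w) (bound ℓ ℓ≢0))

      class-size-point-≤ : ∀ i → class-size (proj₁ (point i)) ≤ h * s
      class-size-point-≤ i = class-bound q≡ (begin
          q * s * (h * s * (q * q + q + 1) + s * class-size (proj₁ (point i)) + q * q * E (point i))
            ≡⟨ cong (λ k → q * s * (k + s * class-size (proj₁ (point i)) + q * q * E (point i))) k≡ ⟨
          q * s * (k + s * class-size (proj₁ (point i)) + q * q * E (point i))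
            ≡⟨ pencil (point i) ⟨
          ∑ pairs (λ ℓ → nz (proj₁ ℓ) * (inc ℓ (point i) * multiplicity ℓ))
            ≤⟨ ∑-mono pairs (pencil-≤ (point i)) ⟩
          ∑ pairs (λ ℓ → nz (proj₁ ℓ) * (inc ℓ (point i) * n))
            ≡⟨ ∑-lines-through-n (point i) (point≢0 i) ⟩
          s * (1 + q) * (q * q) * n ∎)
        (same-point-positive i)
        where open ≤-Reasoning

      -- A class without arc points is trivial. Any other class is that of some arc point, and
      -- rescaling the residue vector does not change its size.
      class-size-≤ : ∀ a → a ≢ 0ᵛ → class-size a ≤ h * s
      class-size-≤ a a≢0 with class-size a ≤? 0
      ... | yes le = ≤-trans le z≤n
      ... | no nle with ∑-positive (allFin k) (≰⇒> nle)
      ...   | i , _ , pos with 𝟙-positive (span? (proj₁ (point i)) a (point≢0 i)) pos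
      ...     | c , refl = ≤-trans (∑-mono (allFin k) (λ j → ≤-reflexive
                  (𝟙-cong (span? (proj₁ (point j)) (c • aᵢ) (point≢0 j)) (span? (proj₁ (point j)) aᵢ (point≢0 j))
                    unscale (λ { (d , eq) → c ⊗ d , trans (cong (c •_) eq) (•-assoc c d _) }))))
                (class-size-point-≤ i)
        where
        aᵢ = proj₁ (point i)
        c≢0 : c ≢ 0ᴷ
        c≢0 refl = a≢0 (•-zeroˡ aᵢ)
        c⁻¹ = proj₁ (inverse c c≢0)
        unscale : ∀ {x} → c • aᵢ ∈⟨ x ⟩ → aᵢ ∈⟨ x ⟩
        unscale {x} (d , eq) = c⁻¹ ⊗ d , (begin
          aᵢ                ≡⟨ •-identity aᵢ ⟨
          1ᴷ • aᵢ           ≡⟨ cong (_• aᵢ) (trans (⊗-comm c⁻¹ c) (proj₂ (inverse c c≢0))) ⟨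
          (c⁻¹ ⊗ c) • aᵢ    ≡⟨ •-assoc c⁻¹ c aᵢ ⟨
          c⁻¹ • c • aᵢ      ≡⟨ cong (c⁻¹ •_) eq ⟩
          c⁻¹ • d • x       ≡⟨ •-assoc c⁻¹ d x ⟩
          (c⁻¹ ⊗ d) • x     ∎)
          where open ≡-Reasoning

      -- The residue of each arc point spans `q` vectors, `s` of them nonzero. The zero vector lies
      -- in every span and accounts for the `k` that is cancelled.
      ∑-class-sizes : ∑ vecs (λ a → nz a * class-size a) ≡ k * s
      ∑-class-sizes = +-cancelʳ-≡ k _ _ (begin
        ∑ vecs (λ a → nz a * class-size a) + k
          ≡⟨ cong (∑ vecs (λ a → nz a * class-size a) +_) (trans (∑-cong (allFin k) (λ j →
               𝟙-yes (span? (proj₁ (point j)) 0ᵛ (point≢0 j)) (0ᴷ , sym (•-zeroˡ _))))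
               (trans (∑-points-const 1) (*-identityʳ k))) ⟨
        ∑ vecs (λ a → nz a * class-size a) + class-size 0ᵛ
          ≡⟨ ∑-≢ 0ᵛ class-size ⟩
        ∑ vecs class-size
          ≡⟨ ∑-swap vecs (allFin k) _ ⟩
        ∑ (allFin k) (λ j → ∑ vecs (λ a → 𝟙 (span? (proj₁ (point j)) a (point≢0 j))))
          ≡⟨ ∑-cong (allFin k) (λ j → span-size (proj₁ (point j)) (point≢0 j)) ⟩
        ∑ (allFin k) (λ _ → q)
          ≡⟨ ∑-points-const q ⟩
        k * q
          ≡⟨ cong (k *_) q≡ ⟩
        k * suc s
          ≡⟨ trans (*-suc k s) (+-comm k (k * s)) ⟩
        k * s + k ∎)
        where open ≡-Reasoning

      nonzero-vectors : ∑ vecs nz + 1 ≡ q * (q * q)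
      nonzero-vectors = trans (cong (_+ 1) (∑-cong vecs (λ a → sym (*-identityʳ (nz a)))))
        (trans (∑-≢ 0ᵛ (λ _ → 1)) (trans ∑1 (cong (λ x → q * (q * x)) (*-identityʳ q))))

      -- `h s` is the mean class size as well as the upper bound, since `k = h s (q² + q + 1)`.
      class-size-≡ : ∀ a → a ≢ 0ᵛ → class-size a ≡ h * s
      class-size-≡ a a≢0 = begin
        class-size a         ≡⟨ *-identityˡ _ ⟨
        1 * class-size a     ≡⟨ cong (_* class-size a) nz≡1 ⟨
        nz a * class-size a  ≡⟨ ∑-tight pointwise (≤-reflexive total) (∈-elements a) ⟩
        nz a * (h * s)       ≡⟨ cong (_* (h * s)) nz≡1 ⟩
        1 * (h * s)          ≡⟨ *-identityˡ _ ⟩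
        h * s                ∎
        where
        open ≡-Reasoning
        nz≡1 : nz a ≡ 1
        nz≡1 = 𝟙-yes (¬? (a ≟ᵛ 0ᵛ)) a≢0
        pointwise : ∀ a → nz a * class-size a ≤ nz a * (h * s)
        pointwise a with a ≟ᵛ 0ᵛ
        ... | yes _  = z≤n
        ... | no a≢0 = *-monoʳ-≤ 1 (class-size-≤ a a≢0)
        cube : ∀ s → (1 + s) * ((1 + s) * (1 + s)) ≡ s * ((1 + s) * (1 + s) + (1 + s) + 1) + 1
        cube = solve-∀
        nz-total : ∑ vecs nz ≡ s * (q * q + q + 1)
        nz-total = +-cancelʳ-≡ 1 _ _ (trans nonzero-vectors
          (subst (λ q → q * (q * q) ≡ s * (q * q + q + 1) + 1) (sym q≡) (cube s)))
        rearrange : ∀ h s x → s * x * (h * s) ≡ h * s * x * s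
        rearrange = solve-∀
        total : ∑ vecs (λ a → nz a * (h * s)) ≡ ∑ vecs (λ a → nz a * class-size a)
        total = begin
          ∑ vecs (λ a → nz a * (h * s))       ≡⟨ ∑-*ʳ vecs (h * s) nz ⟩
          ∑ vecs nz * (h * s)                 ≡⟨ cong (_* (h * s)) nz-total ⟩
          s * (q * q + q + 1) * (h * s)       ≡⟨ rearrange h s (q * q + q + 1) ⟩
          h * s * (q * q + q + 1) * s         ≡⟨ cong (_* s) k≡ ⟨
          k * s                               ≡⟨ ∑-class-sizes ⟨
          ∑ vecs (λ a → nz a * class-size a)  ∎

      pencil′ : ∀ w → proj₁ w ≢ 0ᵛ → ∑ pairs (λ ℓ → nz (proj₁ ℓ) * (inc ℓ w * multiplicity ℓ))
                ≡ q * s * (h * s * (q * q + q + 1) + s * (h * s) + q * q * E w)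
      pencil′ w w≢0 = trans (pencil w)
        (cong₂ (λ k u → q * s * (k + s * u + q * q * E w)) k≡ (class-size-≡ (proj₁ w) w≢0))

      -- The pencil of an arc point reaches the sum it would have if each of its lines held `n`
      -- points, so each of them does.
      secant : ∀ ℓ → proj₁ ℓ ≢ 0ᵛ → ∀ i → 0 < inc ℓ (point i) → multiplicity ℓ ≡ n
      secant ℓ@(α , β) α≢0 i pos = *-cancelˡ-≡ _ _ (inc ℓ (point i)) ⦃ >-nonZero pos ⦄
        (trans (sym (*-identityˡ _)) (trans (subst (λ x → x * (inc ℓ (point i) * multiplicity ℓ) ≡ x * (inc ℓ (point i) * n)) (𝟙-yes (¬? (α ≟ᵛ 0ᵛ)) α≢0)
          (∑-tight (pencil-≤ (point i))
            (≤-trans (≤-reflexive (∑-lines-through-n (point i) (point≢0 i)))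
              (≤-trans (pencil-tight q≡ (same-point-positive i))
                (≤-reflexive (sym (pencil′ (point i) (point≢0 i))))))
            (∈-cartesianProduct⁺ (∈-elements α) (∈-elements β)))) (*-identityˡ _)))

      -- Passants and the parity contradiction

      passant : R³ → ℕ
      passant ℓ = 𝟙 (multiplicity ℓ ≟ℕ 0)

      secant-or-passant : ∀ ℓ → proj₁ ℓ ≢ 0ᵛ → multiplicity ℓ + n * passant ℓ ≡ n
      secant-or-passant ℓ ℓ≢0 = go (multiplicity ℓ ≟ℕ 0)
        where
        go : (d : Dec (multiplicity ℓ ≡ 0)) → multiplicity ℓ + n * 𝟙 d ≡ n
        go (yes eq) = trans (cong (_+ n * 1) eq) (*-identityʳ n)
        go (no neq) with ∑-positive (allFin k) (n≢0⇒n>0 neq)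
        ... | i , _ , pos = trans (cong₂ _+_ (secant ℓ ℓ≢0 i pos) (*-zeroʳ n)) (+-identityʳ n)

      -- The weighted sum of `secant-or-passant`. The weight is incidence with a vector: a nonzero
      -- residue gives the passants through a point, the zero vector all passants.
      complement : (f : R³ → ℕ) →
        ∑ pairs (λ ℓ → nz (proj₁ ℓ) * (f ℓ * multiplicity ℓ)) + n * ∑ pairs (λ ℓ → nz (proj₁ ℓ) * (f ℓ * passant ℓ))
        ≡ ∑ pairs (λ ℓ → nz (proj₁ ℓ) * (f ℓ * n))
      complement f = begin
        ∑ pairs (λ ℓ → nz (proj₁ ℓ) * (f ℓ * multiplicity ℓ)) + n * ∑ pairs (λ ℓ → nz (proj₁ ℓ) * (f ℓ * passant ℓ))
          ≡⟨ cong (∑ pairs (λ ℓ → nz (proj₁ ℓ) * (f ℓ * multiplicity ℓ)) +_) (∑-*ˡ pairs n _) ⟨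
        ∑ pairs (λ ℓ → nz (proj₁ ℓ) * (f ℓ * multiplicity ℓ)) + ∑ pairs (λ ℓ → n * (nz (proj₁ ℓ) * (f ℓ * passant ℓ)))
          ≡⟨ ∑-+ pairs _ _ ⟨
        ∑ pairs (λ ℓ → nz (proj₁ ℓ) * (f ℓ * multiplicity ℓ) + n * (nz (proj₁ ℓ) * (f ℓ * passant ℓ)))
          ≡⟨ ∑-cong pairs (λ ℓ → trans (collect (nz (proj₁ ℓ)) (f ℓ) (multiplicity ℓ) n (passant ℓ))
               (𝟙-*-cong (¬? (proj₁ ℓ ≟ᵛ 0ᵛ)) (λ ℓ≢0 → cong (f ℓ *_) (secant-or-passant ℓ ℓ≢0)))) ⟩
        ∑ pairs (λ ℓ → nz (proj₁ ℓ) * (f ℓ * n)) ∎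
        where
        open ≡-Reasoning
        collect : ∀ a b c d e → a * (b * c) + d * (a * (b * e)) ≡ a * (b * (c + d * e))
        collect = solve-∀

      multiplicity-shift : ∀ α β d → multiplicity (α , β ⊞ d • σᵛ α) ≡ multiplicity (α , β)
      multiplicity-shift α β d = ∑-cong (allFin k) (λ j → inc-shift s q≡ α β d (point j))

      normal-passants : R³ → ℕ
      normal-passants w = ∑ pairs (λ ℓ → nz (proj₁ ℓ) * (normal s q≡ ℓ * (inc ℓ w * passant ℓ)))

      ∑-normal-passants : ∀ w → ∑ pairs (λ ℓ → nz (proj₁ ℓ) * (inc ℓ w * passant ℓ)) ≡ q * normal-passants w
      ∑-normal-passants w = ∑-normal s q≡ _ (λ α β d → cong₂ (λ x y → x * 𝟙 (y ≟ℕ 0))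
        (inc-shift s q≡ α β d w) (multiplicity-shift α β d))

      -- `passants-through` counts `q` rows for each normalised one; dividing by `q` leaves
      -- `2 s (1 - E w)`.
      normal-passants-even : ∀ w → proj₁ w ≢ 0ᵛ → 2 ∣ normal-passants w
      normal-passants-even w w≢0 = ∣m+n∣m⇒∣n
        (subst (2 ∣_) (sym (trans (+-comm (2 * (s * E w)) _) cancelled)) (m∣m*n s)) (m∣m*n (s * E w))
        where
        open ≡-Reasoning
        cancelled : normal-passants w + 2 * (s * E w) ≡ 2 * s
        cancelled = *-cancelˡ-≡ _ _ q (begin
          q * (normal-passants w + 2 * (s * E w))      ≡⟨ *-distribˡ-+ q _ _ ⟩
          q * normal-passants w + q * (2 * (s * E w))  ≡⟨ cong (_+ q * (2 * (s * E w))) (∑-normal-passants w) ⟨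
          ∑ pairs (λ ℓ → nz (proj₁ ℓ) * (inc ℓ w * passant ℓ)) + q * (2 * (s * E w))
            ≡⟨ passants-through q≡ (trans (cong (_+ n * ∑ pairs (λ ℓ → nz (proj₁ ℓ) * (inc ℓ w * passant ℓ))) (sym (pencil′ w w≢0)))
                 (trans (complement (λ ℓ → inc ℓ w)) (∑-lines-through-n w w≢0))) ⟩
          q * (2 * s) ∎)

      -- Not a point: it satisfies every row, so its normalised passants are all passants, `s` rows
      -- each. It enters as the term `p = 0` of the sum over the subplane.
      origin : R³
      origin = 0ᵛ , 0ᵛ

      inc-origin : ∀ ℓ → inc ℓ origin ≡ 1
      inc-origin (α , β) = inc-1 (α , β) origin (∙-zeroʳ α)
        (trans (cong₂ _⊕_ (trans (∙-comm β (σᵛ 0ᵛ)) (trans (cong (_∙ β) σᵛ-0) (∙-zeroˡ β))) (∙-zeroʳ α))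
          (⊕-identityʳ 0ᴷ))
        where
        σᵛ-0 : σᵛ {3} 0ᵛ ≡ 0ᵛ
        σᵛ-0 = cong₂ _∷_ σ-0 (cong₂ _∷_ σ-0 (cong₂ _∷_ σ-0 refl))

      normal-passants-origin : normal-passants origin ≡ s * (q * q + q + 1)
      normal-passants-origin = *-cancelˡ-≡ _ _ q (trans (sym (∑-normal-passants origin))
        (passants q≡ nonzero-vectors (begin
          h * s * (q * q + q + 1) * (s * (1 + q) * (q * q)) + n * ∑ pairs (λ ℓ → nz (proj₁ ℓ) * (inc ℓ origin * passant ℓ))
            ≡⟨ cong (_+ n * ∑ pairs (λ ℓ → nz (proj₁ ℓ) * (inc ℓ origin * passant ℓ))) all-incidences ⟨
          ∑ pairs (λ ℓ → nz (proj₁ ℓ) * (inc ℓ origin * multiplicity ℓ)) + n * ∑ pairs (λ ℓ → nz (proj₁ ℓ) * (inc ℓ origin * passant ℓ))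
            ≡⟨ complement (λ ℓ → inc ℓ origin) ⟩
          ∑ pairs (λ ℓ → nz (proj₁ ℓ) * (inc ℓ origin * n))
            ≡⟨ ∑-cong pairs (λ ℓ → cong (nz (proj₁ ℓ) *_) (trans (cong (_* n) (inc-origin ℓ)) (*-identityˡ n))) ⟩
          ∑ pairs (λ ℓ → nz (proj₁ ℓ) * n)
            ≡⟨ ∑-lines nz (λ _ _ → n) (λ _ → trans (∑-const vecs n) (cong (_* n)
                 (trans (length-vectors finite 3) (cong (λ x → q * (q * x)) (*-identityʳ q))))) ⟩
          ∑ vecs nz * (q * (q * q) * n)
            ≡⟨ *-assoc (∑ vecs nz) (q * (q * q)) n ⟨
          ∑ vecs nz * (q * (q * q)) * n ∎)))
        where
        open ≡-Reasoning
        all-incidences : ∑ pairs (λ ℓ → nz (proj₁ ℓ) * (inc ℓ origin * multiplicity ℓ))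
                         ≡ h * s * (q * q + q + 1) * (s * (1 + q) * (q * q))
        all-incidences = begin
          ∑ pairs (λ ℓ → nz (proj₁ ℓ) * (inc ℓ origin * multiplicity ℓ))
            ≡⟨ ∑-cong pairs (λ ℓ → trans (cong (nz (proj₁ ℓ) *_) (trans (cong (_* multiplicity ℓ) (inc-origin ℓ))
                 (*-identityˡ (multiplicity ℓ)))) (sym (∑-*ˡ (allFin k) (nz (proj₁ ℓ)) _))) ⟩
          ∑ pairs (λ ℓ → ∑ (allFin k) (λ j → nz (proj₁ ℓ) * inc ℓ (point j)))
            ≡⟨ ∑-swap pairs (allFin k) _ ⟩
          ∑ (allFin k) (λ j → ∑ pairs (λ ℓ → nz (proj₁ ℓ) * inc ℓ (point j)))
            ≡⟨ ∑-cong (allFin k) (λ j → lines-through s q≡ (point j) (point≢0 j)) ⟩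
          ∑ (allFin k) (λ _ → s * (1 + q) * (q * q))
            ≡⟨ ∑-points-const _ ⟩
          k * (s * (1 + q) * (q * q))
            ≡⟨ cong (_* (s * (1 + q) * (q * q))) k≡ ⟩
          h * s * (q * q + q + 1) * (s * (1 + q) * (q * q)) ∎

      2∣q : 2 ∣ q
      2∣q = divides h (trans q≡ (trans (sym (*-distribˡ-+ 2 1 g)) (*-comm 2 h)))

      -- Grouped by rows instead of points, each row contributes a multiple of its number of
      -- subplane vectors.
      subplane-total-even : 2 ∣ ∑ vecs (λ p → normal-passants (p , 0ᵛ))
      subplane-total-even = subst (2 ∣_) (sym (∑-swap vecs pairs _)) (∑-∣ pairs even)
        where
        even : ∀ ℓ → 2 ∣ ∑ vecs (λ p → nz (proj₁ ℓ) * (normal s q≡ ℓ * (inc ℓ (p , 0ᵛ) * passant ℓ)))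
        even ℓ@(α , β) = subst (2 ∣_) (sym (begin
          ∑ vecs (λ p → nz α * (normal s q≡ ℓ * (inc ℓ (p , 0ᵛ) * passant ℓ)))
            ≡⟨ ∑-cong vecs (λ p → rearrange (nz α) (normal s q≡ ℓ) (inc ℓ (p , 0ᵛ)) (passant ℓ)) ⟩
          ∑ vecs (λ p → normal s q≡ ℓ * passant ℓ * (nz α * inc ℓ (p , 0ᵛ)))
            ≡⟨ trans (∑-*ˡ vecs (normal s q≡ ℓ * passant ℓ) _) (cong (normal s q≡ ℓ * passant ℓ *_) (∑-*ˡ vecs (nz α) _)) ⟩
          normal s q≡ ℓ * passant ℓ * (nz α * ∑ vecs (λ p → inc ℓ (p , 0ᵛ))) ∎))
          (∣n⇒∣m*n (normal s q≡ ℓ * passant ℓ) nz-even)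
          where
          open ≡-Reasoning
          rearrange : ∀ a b c d → a * (b * (c * d)) ≡ b * d * (a * c)
          rearrange = solve-∀
          nz-even : 2 ∣ nz α * ∑ vecs (λ p → inc ℓ (p , 0ᵛ))
          nz-even with α ≟ᵛ 0ᵛ
          ... | yes _  = 2 ∣0
          ... | no α≢0 = ∣n⇒∣m*n 1 (subplane-even s q≡ α β α≢0 2∣q)

      -- In the sum over the subplane the total and all terms with `p ≢ 0ᵛ` are even, so the
      -- remaining term, the odd number at the origin, would be even too.
      no-arc : ⊥
      no-arc = passants-odd q≡ (subst (2 ∣_) normal-passants-origin
        (∣m+n∣m⇒∣n (subst (2 ∣_) (sym (∑-≢ 0ᵛ (λ p → normal-passants (p , 0ᵛ)))) subplane-total-even)
          (∑-∣ vecs even)))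
        where
        even : ∀ p → 2 ∣ nz p * normal-passants (p , 0ᵛ)
        even p with p ≟ᵛ 0ᵛ
        ... | yes _  = 2 ∣0
        ... | no p≢0 = ∣n⇒∣m*n 1 (normal-passants-even (p , 0ᵛ) p≢0)

-- Lines as kernels of unimodular rows

module KernelLine {a b : Level} (A : Ring a (a ⊔ b)) where
  open Ring A hiding (zero)
  open PHG A
  open RingProperties A using (-‿distribˡ-*; -‿distribʳ-*)
  open AbelianGroupProperties +-abelianGroup using (⁻¹-∙-comm; inverseʳ-unique)
  open CommutativeSemigroupProperties +-commutativeSemigroup using (interchange; x∙yz≈y∙xz)
  open SetoidReasoning setoid

  Triple : Set a
  Triple = Carrier × Carrier × Carrier

  pairing : Triple → Triple → Carrier
  pairing (x , y , z) (u , v , w) = x * u + (y * v + z * w)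

  pairing-zero : ∀ ρ → pairing ρ (0# , 0# , 0#) ≈ 0#
  pairing-zero (x , y , z) = begin
    x * 0# + (y * 0# + z * 0#)  ≈⟨ +-cong (zeroʳ x) (+-cong (zeroʳ y) (zeroʳ z)) ⟩
    0# + (0# + 0#)              ≈⟨ trans (+-identityˡ _) (+-identityˡ _) ⟩
    0#                          ∎

  pairing-+ : ∀ ρ u v u′ v′ w w′ → pairing ρ (u + u′ , v + v′ , w + w′) ≈ pairing ρ (u , v , w) + pairing ρ (u′ , v′ , w′)
  pairing-+ (x , y , z) u v u′ v′ w w′ = begin
    x * (u + u′) + (y * (v + v′) + z * (w + w′))
      ≈⟨ +-cong (distribˡ _ _ _) (+-cong (distribˡ _ _ _) (distribˡ _ _ _)) ⟩
    (x * u + x * u′) + ((y * v + y * v′) + (z * w + z * w′))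
      ≈⟨ +-congˡ (interchange _ _ _ _) ⟩
    (x * u + x * u′) + ((y * v + z * w) + (y * v′ + z * w′))
      ≈⟨ interchange _ _ _ _ ⟩
    (x * u + (y * v + z * w)) + (x * u′ + (y * v′ + z * w′)) ∎

  pairing-* : ∀ ρ u v w c → pairing ρ (u * c , v * c , w * c) ≈ pairing ρ (u , v , w) * c
  pairing-* (x , y , z) u v w c = begin
    x * (u * c) + (y * (v * c) + z * (w * c))
      ≈⟨ +-cong (*-assoc _ _ _) (+-cong (*-assoc _ _ _) (*-assoc _ _ _)) ⟨
    x * u * c + (y * v * c + z * w * c)
      ≈⟨ +-congˡ (distribʳ c _ _) ⟨
    x * u * c + (y * v + z * w) * c
      ≈⟨ distribʳ c _ _ ⟨
    (x * u + (y * v + z * w)) * c ∎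

  -- Rows act from the left, so the kernel is a right submodule. The equality of `A` is taken at
  -- level `a ⊔ b`, where `Member` has to live.
  kernel : Triple → Submodule
  kernel ρ@(x , y , z) = record
    { Member    = λ v → pairing ρ v ≈ 0#
    ; respects  = λ { (e , f , g) m → trans (sym (+-cong (*-congˡ e) (+-cong (*-congˡ f) (*-congˡ g)))) m }
    ; 0-closed  = pairing-zero ρ
    ; +-closed  = λ m m′ → trans (pairing-+ ρ _ _ _ _ _ _) (trans (+-cong m m′) (+-identityˡ 0#))
    ; *ᵣ-closed = λ c m → trans (pairing-* ρ _ _ _ c) (trans (*-congʳ m) (zeroˡ c))
    }

  Unit : Carrier → Set (a ⊔ b)
  Unit x = ∃ λ x⁻¹ → x * x⁻¹ ≈ 1# × x⁻¹ * x ≈ 1#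

  pair : Carrier → Carrier → Fin 2 → Carrier
  pair v w zero       = v
  pair v w (suc zero) = w

  -- A unit entry `x` allows solving for `u = - x⁻¹ (y v + z w)`, which leaves `v` and `w` as free
  -- coordinates.
  kernel-free₁ : ∀ {x} y z → Unit x → IsFreeOfRank 2 (kernel (x , y , z))
  kernel-free₁ {x} y z (x⁻¹ , xx⁻¹ , x⁻¹x) = record
    { basis       = basis
    ; basis∈      = λ { zero → basis∈₀ ; (suc zero) → basis∈₁ }
    ; spanning    = λ { (u , v , w) m → pair v w , solve-u u v w m , v≈ v w , w≈ v w }
    ; independent = λ { c (_ , f , g) zero       → trans (v≈ (c zero) (c (suc zero))) f
                      ; c (_ , f , g) (suc zero) → trans (w≈ (c zero) (c (suc zero))) g }
    }
    where
    basis : Fin 2 → Triple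
    basis zero       = - (x⁻¹ * y) , 1# , 0#
    basis (suc zero) = - (x⁻¹ * z) , 0# , 1#

    cancel-x : ∀ t → x * - (x⁻¹ * t) ≈ - t
    cancel-x t = begin
      x * - (x⁻¹ * t)    ≈⟨ -‿distribʳ-* x _ ⟨
      - (x * (x⁻¹ * t))  ≈⟨ -‿cong (trans (sym (*-assoc _ _ _)) (trans (*-congʳ xx⁻¹) (*-identityˡ t))) ⟩
      - t                ∎

    basis∈₀ : pairing (x , y , z) (basis zero) ≈ 0#
    basis∈₀ = begin
      x * - (x⁻¹ * y) + (y * 1# + z * 0#)  ≈⟨ +-cong (cancel-x y) (trans (+-cong (*-identityʳ y) (zeroʳ z)) (+-identityʳ y)) ⟩
      - y + y                              ≈⟨ -‿inverseˡ y ⟩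
      0#                                   ∎

    basis∈₁ : pairing (x , y , z) (basis (suc zero)) ≈ 0#
    basis∈₁ = begin
      x * - (x⁻¹ * z) + (y * 0# + z * 1#)  ≈⟨ +-cong (cancel-x z) (trans (+-cong (zeroʳ y) (*-identityʳ z)) (+-identityˡ z)) ⟩
      - z + z                              ≈⟨ -‿inverseˡ z ⟩
      0#                                   ∎

    v≈ : ∀ v w → v ≈ 1# * v + (0# * w + 0#)
    v≈ v w = sym (trans (+-cong (*-identityˡ v) (trans (+-identityʳ _) (zeroˡ w))) (+-identityʳ v))

    w≈ : ∀ v w → w ≈ 0# * v + (1# * w + 0#)
    w≈ v w = sym (trans (+-cong (zeroˡ v) (trans (+-identityʳ _) (*-identityˡ w))) (+-identityˡ w))

    solve-u : ∀ u v w → pairing (x , y , z) (u , v , w) ≈ 0# →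
              u ≈ - (x⁻¹ * y) * v + (- (x⁻¹ * z) * w + 0#)
    solve-u u v w m = begin
      u
        ≈⟨ inverseʳ-unique _ _ (trans (+-comm _ u) annihilated) ⟩
      - (x⁻¹ * (y * v + z * w))
        ≈⟨ -‿cong (trans (distribˡ _ _ _) (+-cong (sym (*-assoc _ _ _)) (sym (*-assoc _ _ _)))) ⟩
      - (x⁻¹ * y * v + x⁻¹ * z * w)
        ≈⟨ ⁻¹-∙-comm _ _ ⟨
      - (x⁻¹ * y * v) + - (x⁻¹ * z * w)
        ≈⟨ +-cong (-‿distribˡ-* _ v) (trans (-‿distribˡ-* _ w) (sym (+-identityʳ _))) ⟩
      - (x⁻¹ * y) * v + (- (x⁻¹ * z) * w + 0#) ∎
      where
      annihilated : u + x⁻¹ * (y * v + z * w) ≈ 0#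
      annihilated = begin
        u + x⁻¹ * (y * v + z * w)            ≈⟨ +-congʳ (trans (sym (*-identityˡ u)) (trans (*-congʳ (sym x⁻¹x)) (*-assoc _ _ _))) ⟩
        x⁻¹ * (x * u) + x⁻¹ * (y * v + z * w)  ≈⟨ distribˡ _ _ _ ⟨
        x⁻¹ * (x * u + (y * v + z * w))      ≈⟨ *-congˡ m ⟩
        x⁻¹ * 0#                             ≈⟨ zeroʳ _ ⟩
        0#                                   ∎

  swap₁₂ : Triple → Triple
  swap₁₂ (u , v , w) = v , u , w

  swap₂₃ : Triple → Triple
  swap₂₃ (u , v , w) = u , w , v

  pairing-swap₁₂ : ∀ ρ v → pairing (swap₁₂ ρ) (swap₁₂ v) ≈ pairing ρ v
  pairing-swap₁₂ (x , y , z) (u , v , w) = x∙yz≈y∙xz _ _ _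

  pairing-swap₂₃ : ∀ ρ v → pairing (swap₂₃ ρ) (swap₂₃ v) ≈ pairing ρ v
  pairing-swap₂₃ (x , y , z) (u , v , w) = +-congˡ (+-comm _ _)

  kernel-free-swap₁₂ : ∀ ρ → IsFreeOfRank 2 (kernel (swap₁₂ ρ)) → IsFreeOfRank 2 (kernel ρ)
  kernel-free-swap₁₂ ρ free = record
    { basis       = λ i → swap₁₂ (basis i)
    ; basis∈      = λ i → trans (sym (pairing-swap₁₂ ρ (swap₁₂ (basis i)))) (basis∈ i)
    ; spanning    = λ u m → let (c , e , f , g) = spanning (swap₁₂ u) (trans (pairing-swap₁₂ ρ u) m)
                            in c , f , e , g
    ; independent = λ { c (e , f , g) → independent c (f , e , g) }
    }
    where open IsFreeOfRank free

  kernel-free-swap₂₃ : ∀ ρ → IsFreeOfRank 2 (kernel (swap₂₃ ρ)) → IsFreeOfRank 2 (kernel ρ)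
  kernel-free-swap₂₃ ρ free = record
    { basis       = λ i → swap₂₃ (basis i)
    ; basis∈      = λ i → trans (sym (pairing-swap₂₃ ρ (swap₂₃ (basis i)))) (basis∈ i)
    ; spanning    = λ u m → let (c , e , f , g) = spanning (swap₂₃ u) (trans (pairing-swap₂₃ ρ u) m)
                            in c , e , g , f
    ; independent = λ { c (e , f , g) → independent c (e , g , f) }
    }
    where open IsFreeOfRank free

  kernel-free₂ : ∀ x {y} z → Unit y → IsFreeOfRank 2 (kernel (x , y , z))
  kernel-free₂ x {y} z unit = kernel-free-swap₁₂ (x , y , z) (kernel-free₁ x z unit)

  kernel-free₃ : ∀ x y {z} → Unit z → IsFreeOfRank 2 (kernel (x , y , z))
  kernel-free₃ x y {z} unit = kernel-free-swap₂₃ (x , y , z) (kernel-free₂ x y unit)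

  -- The form that unimodularity takes over a local ring such as `R`.
  Unimodular : Triple → Set (a ⊔ b)
  Unimodular (x , y , z) = Unit x ⊎ Unit y ⊎ Unit z

  kernel-free : ∀ ρ → Unimodular ρ → IsFreeOfRank 2 (kernel ρ)
  kernel-free (x , y , z) (inj₁ unit)        = kernel-free₁ y z unit
  kernel-free (x , y , z) (inj₂ (inj₁ unit)) = kernel-free₂ x z unit
  kernel-free (x , y , z) (inj₂ (inj₂ unit)) = kernel-free₃ x y unit

  spanning-vector : Point → Triple
  spanning-vector (_ , free) = IsFreeOfRank.basis free zero

  spanning-vector-torsion-free : ∀ P t → let (u , v , w) = spanning-vector P in
    u * t ≈ 0# → v * t ≈ 0# → w * t ≈ 0# → t ≈ 0#
  spanning-vector-torsion-free (_ , free) t e f g = IsFreeOfRank.independent free (λ _ → t)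
    (trans (+-identityʳ _) e , trans (+-identityʳ _) f , trans (+-identityʳ _) g) zero

  on-kernel : ∀ P ρ unimodular → pairing ρ (spanning-vector P) ≈ 0# →
              P on (kernel ρ , kernel-free ρ unimodular)
  on-kernel (_ , free) ρ unimodular orthogonal u u∈ =
    let (c , u≈) = IsFreeOfRank.spanning free u u∈ in
    N.respects (≈ᴹ-sym u≈) (N.+-closed (N.*ᵣ-closed (c zero) orthogonal) N.0-closed)
    where
    module N = Submodule (kernel ρ)
    open RightModule R³ using (≈ᴹ-sym)

  -- The arc condition for the line cut out by a row, tested on one spanning vector per point.
  arc-bound : ∀ {k n} (arc : ProjectiveArc k n) ρ → Unimodular ρ → (S : Subset k) →
    (∀ {i} → i ∈ˢ S → pairing ρ (spanning-vector (ProjectiveArc.point arc i)) ≈ 0#) → ∣ S ∣ ≤ n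
  arc-bound arc ρ unimodular S orthogonal = meets≤ (kernel ρ , kernel-free ρ unimodular) S
    (λ {i} i∈S → on-kernel (point i) ρ unimodular (orthogonal i∈S))
    where open ProjectiveArc arc

∣tabulate∣ : ∀ k (p : Fin k → Bool) → ∣ Vec.tabulate p ∣ ≡ ∑ (allFin k) (λ i → if p i then 1 else 0)
∣tabulate∣ zero    p = ≡.refl
∣tabulate∣ (suc k) p = ≡.trans (∣∷∣ (p zero) (Vec.tabulate (λ i → p (suc i)))) (≡.trans
  (≡.cong ((if p zero then 1 else 0) +ℕ_) (∣tabulate∣ k (λ i → p (suc i))))
  (≡.sym (∑-allFin-suc k (λ i → if p i then 1 else 0))))
  where
  ∣∷∣ : ∀ b (S : Subset k) → ∣ b ∷ S ∣ ≡ (if b then 1 else 0) +ℕ ∣ S ∣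
  ∣∷∣ false S = ≡.refl
  ∣∷∣ true  S = ≡.refl

does-true : {P : Set} (d : Dec P) → does d ≡ true → P
does-true (yes p) _ = p

if-∧ : ∀ b c → (if b ∧ c then 1 else 0) ≡ (if b then 1 else 0) *ℕ (if c then 1 else 0)
if-∧ false c     = ≡.refl
if-∧ true  false = ≡.refl
if-∧ true  true  = ≡.refl

-- Coordinates over a field with propositional equality

module Transport {c ℓ : Level} (F : CommutativeRing c ℓ) {q : ℕ} (field-F : IsFiniteField F q) where
  open CommutativeRing F hiding (zero)
  open IsFiniteField field-F
  open Inverse enumeration using (to; from; to-cong; from-cong; inverseˡ; inverseʳ)

  to∘from : ∀ i → to (from i) ≡ i
  to∘from i = inverseˡ refl

  from∘to : ∀ x → from (to x) ≈ x
  from∘to x = inverseʳ ≡.refl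

  rawRing-Fin : RawRing 0ℓ 0ℓ
  rawRing-Fin = record
    { Carrier = Fin q
    ; _≈_     = _≡_
    ; _+_     = λ i j → to (from i + from j)
    ; _*_     = λ i j → to (from i * from j)
    ; -_      = λ i → to (- from i)
    ; 0#      = to 0#
    ; 1#      = to 1#
    }

  -- The ring laws on `Fin q` are pulled back along the injection `from`, giving a field with
  -- decidable propositional equality for the counting.
  from-isRingMonomorphism : IsRingMonomorphism rawRing-Fin rawRing from
  from-isRingMonomorphism = record
    { isRingHomomorphism = record
      { isSemiringHomomorphism = record
        { isNearSemiringHomomorphism = record
          { +-isMonoidHomomorphism = record
            { isMagmaHomomorphism = record
              { isRelHomomorphism = record { cong = from-cong }
              ; homo = λ i j → from∘to _
              }
            ; ε-homo = from∘to _
            }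
          ; *-homo = λ i j → from∘to _
          }
        ; 1#-homo = from∘to _
        }
      ; -‿homo = λ i → from∘to _
      }
    ; injective = λ {i} {j} eq → ≡.trans (≡.sym (to∘from i)) (≡.trans (to-cong eq) (to∘from j))
    }

  finiteField : FiniteField (Fin q)
  finiteField = record
    { _⊕_               = RawRing._+_ rawRing-Fin
    ; _⊗_               = RawRing._*_ rawRing-Fin
    ; ⊝_                = RawRing.-_ rawRing-Fin
    ; 0ᴷ                = to 0#
    ; 1ᴷ                = to 1#
    ; isCommutativeRing = RingMonomorphism.isCommutativeRing from-isRingMonomorphism isCommutativeRing
    ; 1≢0               = λ eq → 1≉0 (trans (sym (from∘to 1#)) (trans (from-cong eq) (from∘to 0#)))
    ; inverse           = λ i i≢0 →
        let (y , xy) = invertible (from i) (λ eq → i≢0 (≡.trans (≡.sym (to∘from i)) (to-cong eq)))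
        in to y , to-cong (trans (*-congˡ (from∘to y)) xy)
    ; finite            = finite-Fin q
    }

module Coordinates {c ℓ : Level} (F : CommutativeRing c ℓ) {q : ℕ} (field-F : IsFiniteField F q)
                   (σ : CommutativeRing.Carrier F → CommutativeRing.Carrier F) (σ-aut : IsAutomorphism F σ) where
  open CommutativeRing F hiding (zero)
  open IsFiniteField field-F
  open Inverse enumeration using (to; from; to-cong; from-cong)
  open Transport F field-F
  open RingMorphisms rawRing rawRing using (module IsRingIsomorphism)
  open IsRingIsomorphism σ-aut using (surjective)
    renaming (⟦⟧-cong to σ-cong′; +-homo to σ-+; *-homo to σ-*; 0#-homo to σ-0; 1#-homo to σ-1)
  open SkewPolynomial F σ σ-aut renaming (_⊕_ to _⊕ₚ_)
  open PrincipalQuotient skewPolynomialRing X²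
  open FiniteField finiteField using (_⊕_; _⊗_; 0ᴷ; 1ᴷ)
  open LinearAlgebra finiteField using (V; _∙_; 0ᵛ)
  open Finite (finite-Fin q) using (_≟_)
  open RingProperties ring using (-‿distribˡ-*; -‿distribʳ-*)

  σ′ σ′⁻¹ : Fin q → Fin q
  σ′   i = to (σ (from i))
  σ′⁻¹ i = to (proj₁ (surjective (from i)))

  σ′-⊕ : ∀ i j → σ′ (i ⊕ j) ≡ σ′ i ⊕ σ′ j
  σ′-⊕ i j = to-cong (trans (σ-cong′ (from∘to _)) (trans (σ-+ _ _) (sym (+-cong (from∘to _) (from∘to _)))))

  σ′-⊗ : ∀ i j → σ′ (i ⊗ j) ≡ σ′ i ⊗ σ′ j
  σ′-⊗ i j = to-cong (trans (σ-cong′ (from∘to _)) (trans (σ-* _ _) (sym (*-cong (from∘to _) (from∘to _)))))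

  σ′-0 : σ′ 0ᴷ ≡ 0ᴷ
  σ′-0 = to-cong (trans (σ-cong′ (from∘to _)) σ-0)

  σ′-1 : σ′ 1ᴷ ≡ 1ᴷ
  σ′-1 = to-cong (trans (σ-cong′ (from∘to _)) σ-1)

  σ′σ′⁻¹ : ∀ i → σ′ (σ′⁻¹ i) ≡ i
  σ′σ′⁻¹ i = ≡.trans (to-cong (proj₂ (surjective (from i)) (from∘to _))) (to∘from i)

  automorphism : Automorphism finiteField
  automorphism = record
    { σ = σ′ ; σ⁻¹ = σ′⁻¹ ; σ-⊕ = σ′-⊕ ; σ-⊗ = σ′-⊗ ; σ-0 = σ′-0 ; σ-1 = σ′-1 ; σσ⁻¹ = σ′σ′⁻¹ }

  -- The quotient by X² in terms of the two lowest coefficients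

  coeff₀-⊛ : ∀ p r → coeff (p ⊛ r) 0 ≈ coeff p 0 * coeff r 0
  coeff₀-⊛ []      r = sym (zeroˡ _)
  coeff₀-⊛ (a ∷ p) r = trans (coeff-⊕ (a · r) _ 0) (trans (+-identityʳ _) (coeff-· a r 0))

  coeff₁-⊛ : ∀ p r → coeff (p ⊛ r) 1 ≈ coeff p 0 * coeff r 1 + coeff p 1 * σ (coeff r 0)
  coeff₁-⊛ []      r = sym (trans (+-cong (zeroˡ _) (zeroˡ _)) (+-identityˡ _))
  coeff₁-⊛ (a ∷ p) r = trans (coeff-⊕ (a · r) _ 1)
    (+-cong (coeff-· a r 1) (trans (coeff₀-⊛ p (List.map σ r)) (*-congˡ (coeff-σ r 0))))

  -- Induction over the generated ideal: the two lowest coefficients of a product depend only on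
  -- those of the factors and vanish when those of one factor do.
  ideal-coeff : ∀ {x} → ⟨g⟩ x → coeff x 0 ≈ 0# × coeff x 1 ≈ 0#
  ideal-coeff generator = refl , refl
  ideal-coeff (respects e i) =
    let (i₀ , i₁) = ideal-coeff i in trans (sym (coeff≈ e 0)) i₀ , trans (sym (coeff≈ e 1)) i₁
  ideal-coeff (+-closed {x} {y} i j) =
    let (i₀ , i₁) = ideal-coeff i; (j₀ , j₁) = ideal-coeff j in
    trans (coeff-⊕ x y 0) (trans (+-cong i₀ j₀) (+-identityˡ _)) ,
    trans (coeff-⊕ x y 1) (trans (+-cong i₁ j₁) (+-identityˡ _))
  ideal-coeff (*-closedˡ a {x} i) =
    let (i₀ , i₁) = ideal-coeff i in
    trans (coeff₀-⊛ a x) (trans (*-congˡ i₀) (zeroʳ _)) ,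
    trans (coeff₁-⊛ a x) (trans (+-cong (trans (*-congˡ i₁) (zeroʳ _))
      (trans (*-congˡ (trans (σ-cong′ i₀) σ-0)) (zeroʳ _))) (+-identityˡ _))
  ideal-coeff (*-closedʳ {x} a i) =
    let (i₀ , i₁) = ideal-coeff i in
    trans (coeff₀-⊛ x a) (trans (*-congʳ i₀) (zeroˡ _)) ,
    trans (coeff₁-⊛ x a) (trans (+-cong (trans (*-congʳ i₀) (zeroˡ _)) (trans (*-congʳ i₁) (zeroˡ _))) (+-identityˡ _))

  -- `σ` fixes 0 and 1, hence the coefficients of `X²`, so multiplying by it on the right is a plain
  -- shift.
  ⊛-X² : ∀ p → p ⊛ X² ≋ 0# ∷ 0# ∷ p
  ⊛-X² []      = mk≋ λ { 0 → refl ; 1 → refl ; (suc (suc i)) → refl }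
  ⊛-X² (a ∷ p) = mk≋ λ i → trans (coeff-⊕ (a · X²) (0# ∷ (p ⊛ List.map σ X²)) i) (go i)
    where
    shifted : p ⊛ List.map σ X² ≋ 0# ∷ 0# ∷ p
    shifted = mk≋ λ i → trans (coeff≈ (⊛-congˡ p (∷-cong σ-0 (∷-cong σ-0 (∷-cong σ-1 (mk≋ λ _ → refl))))) i)
                              (coeff≈ (⊛-X² p) i)
    go : ∀ i → coeff (a · X²) i + coeff (0# ∷ (p ⊛ List.map σ X²)) i ≈ coeff (0# ∷ 0# ∷ a ∷ p) i
    go 0 = trans (+-congʳ (zeroʳ a)) (+-identityˡ _)
    go 1 = trans (+-cong (zeroʳ a) (coeff≈ shifted 0)) (+-identityˡ _)
    go 2 = trans (+-cong (*-identityʳ a) (coeff≈ shifted 1)) (+-identityʳ _)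
    go (suc (suc (suc i))) = trans (+-identityˡ _) (coeff≈ shifted (suc (suc i)))

  coeff-ideal : ∀ x → coeff x 0 ≈ 0# → coeff x 1 ≈ 0# → ⟨g⟩ x
  coeff-ideal []            _  _  = 0∈
  coeff-ideal (a ∷ [])      e₀ _  = respects (mk≋ λ { 0 → sym e₀ ; (suc i) → refl }) 0∈
  coeff-ideal (a ∷ b ∷ p)   e₀ e₁ = respects
    (mk≋ λ { 0 → trans (coeff≈ (⊛-X² p) 0) (sym e₀)
           ; 1 → trans (coeff≈ (⊛-X² p) 1) (sym e₁)
           ; (suc (suc i)) → coeff≈ (⊛-X² p) (suc (suc i)) })
    (*-closedˡ p generator)

  coeff⇒≈/ : ∀ x y → coeff x 0 ≈ coeff y 0 → coeff x 1 ≈ coeff y 1 → x ≈/ y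
  coeff⇒≈/ x y e₀ e₁ = mk≈/ (coeff-ideal _ (diff 0 e₀) (diff 1 e₁))
    where
    diff : ∀ i → coeff x i ≈ coeff y i → coeff (x ⊕ₚ ⊖ y) i ≈ 0#
    diff i e = trans (coeff-⊕ x (⊖ y) i) (trans (+-cong e (coeff-⊖ y i)) (-‿inverseʳ _))

  R : Ring c (c ⊔ ℓ)
  R = F [X⨟ σ , σ-aut ]/X²

  open KernelLine {b = ℓ} R using (Triple; pairing; Unit; Unimodular; spanning-vector; spanning-vector-torsion-free; arc-bound)

  unit : ∀ i j → i ≢ 0ᴷ → Unit (from i ∷ from j ∷ [])
  unit i j i≢0 = (y ∷ z ∷ []) , coeff⇒≈/ (x ⊛ x⁻¹) (1# ∷ []) right₀ right₁ , coeff⇒≈/ (x⁻¹ ⊛ x) (1# ∷ []) left₀ left₁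
    where
    open SetoidReasoning setoid
    a b y z : Carrier
    a = from i
    b = from j
    a⁻¹ : ∃ λ y → a * y ≈ 1#
    a⁻¹ = invertible a (λ a≈0 → i≢0 (≡.trans (≡.sym (to∘from i)) (to-cong a≈0)))
    y = proj₁ a⁻¹
    -- From `(a + bX)⁻¹ = a⁻¹ - a⁻¹ bX a⁻¹` modulo `X²`, where `X a⁻¹ = σ(a⁻¹) X`.
    z = - (y * b * σ y)
    x x⁻¹ : Poly
    x   = a ∷ b ∷ []
    x⁻¹ = y ∷ z ∷ []
    ya : y * a ≈ 1#
    ya = trans (*-comm y a) (proj₂ a⁻¹)
    right₀ : coeff (x ⊛ x⁻¹) 0 ≈ 1#
    right₀ = trans (coeff₀-⊛ x x⁻¹) (proj₂ a⁻¹)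
    left₀ : coeff (x⁻¹ ⊛ x) 0 ≈ 1#
    left₀ = trans (coeff₀-⊛ x⁻¹ x) ya
    right₁ : coeff (x ⊛ x⁻¹) 1 ≈ 0#
    right₁ = begin
      coeff (x ⊛ x⁻¹) 1             ≈⟨ coeff₁-⊛ x x⁻¹ ⟩
      a * z + b * σ y               ≈⟨ +-congʳ (-‿distribʳ-* a _) ⟨
      - (a * (y * b * σ y)) + b * σ y
        ≈⟨ +-congʳ (-‿cong (trans (*-congˡ (*-assoc y b (σ y))) (trans (sym (*-assoc a y _)) (trans (*-congʳ (proj₂ a⁻¹)) (*-identityˡ _))))) ⟩
      - (b * σ y) + b * σ y         ≈⟨ -‿inverseˡ _ ⟩
      0#                            ∎
    left₁ : coeff (x⁻¹ ⊛ x) 1 ≈ 0#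
    left₁ = begin
      coeff (x⁻¹ ⊛ x) 1                ≈⟨ coeff₁-⊛ x⁻¹ x ⟩
      y * b + z * σ a                  ≈⟨ +-congˡ (-‿distribˡ-* _ (σ a)) ⟨
      y * b + - (y * b * σ y * σ a)
        ≈⟨ +-congˡ (-‿cong (trans (*-assoc _ _ _) (trans (*-congˡ (trans (sym (σ-* y a)) (trans (σ-cong′ ya) σ-1))) (*-identityʳ _)))) ⟩
      y * b + - (y * b)                ≈⟨ -‿inverseʳ _ ⟩
      0#                               ∎

  row : V 3 → V 3 → Triple
  row (α₁ ∷ α₂ ∷ α₃ ∷ []) (β₁ ∷ β₂ ∷ β₃ ∷ []) =
    (from α₁ ∷ from β₁ ∷ []) , (from α₂ ∷ from β₂ ∷ []) , (from α₃ ∷ from β₃ ∷ [])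

  row-unimodular : ∀ α β → α ≢ 0ᵛ → Unimodular (row α β)
  row-unimodular (α₁ ∷ α₂ ∷ α₃ ∷ []) (β₁ ∷ β₂ ∷ β₃ ∷ []) α≢0 = go (α₁ ≟ 0ᴷ) (α₂ ≟ 0ᴷ) (α₃ ≟ 0ᴷ)
    where
    go : Dec (α₁ ≡ 0ᴷ) → Dec (α₂ ≡ 0ᴷ) → Dec (α₃ ≡ 0ᴷ) →
         Unimodular ((from α₁ ∷ from β₁ ∷ []) , (from α₂ ∷ from β₂ ∷ []) , (from α₃ ∷ from β₃ ∷ []))
    go (no α₁≢0)  _          _          = inj₁ (unit α₁ β₁ α₁≢0)
    go (yes _)    (no α₂≢0)  _          = inj₂ (inj₁ (unit α₂ β₂ α₂≢0))
    go (yes _)    (yes _)    (no α₃≢0)  = inj₂ (inj₂ (unit α₃ β₃ α₃≢0))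
    go (yes α₁≡0) (yes α₂≡0) (yes α₃≡0) =
      ⊥-elim (α≢0 (≡.cong₂ _∷_ α₁≡0 (≡.cong₂ _∷_ α₂≡0 (≡.cong₂ _∷_ α₃≡0 ≡.refl))))

  coordinates : ℕ → Triple → V 3
  coordinates i (u , v , w) = to (coeff u i) ∷ to (coeff v i) ∷ to (coeff w i) ∷ []

  from-∙ : ∀ x₁ x₂ x₃ y₁ y₂ y₃ →
    from ((x₁ ∷ x₂ ∷ x₃ ∷ []) ∙ (y₁ ∷ y₂ ∷ y₃ ∷ [])) ≈ from x₁ * from y₁ + (from x₂ * from y₂ + from x₃ * from y₃)
  from-∙ x₁ x₂ x₃ y₁ y₂ y₃ = trans (from∘to _) (+-cong (from∘to _)
    (trans (from∘to _) (+-cong (from∘to _)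
      (trans (from∘to _) (trans (+-cong (from∘to _) (from∘to 0#)) (+-identityʳ _))))))

  pairing-≈0 : ∀ α β v → α ∙ coordinates 0 v ≡ 0ᴷ →
               β ∙ Vec.map σ′ (coordinates 0 v) ⊕ α ∙ coordinates 1 v ≡ 0ᴷ →
               pairing (row α β) v ≈/ []
  pairing-≈0 α@(α₁ ∷ α₂ ∷ α₃ ∷ []) β@(β₁ ∷ β₂ ∷ β₃ ∷ []) t@(u , v , w) eq₀ eq₁ = coeff⇒≈/ (pairing (row α β) t) [] at₀ at₁
    where
    open SetoidReasoning setoid
    open SemiringSolver commutativeSemiring using (solve; _:+_; _:=_)
    ρ₁ ρ₂ ρ₃ : Poly
    ρ₁ = from α₁ ∷ from β₁ ∷ []
    ρ₂ = from α₂ ∷ from β₂ ∷ []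
    ρ₃ = from α₃ ∷ from β₃ ∷ []
    coeff-pairing : ∀ i → coeff (pairing (ρ₁ , ρ₂ , ρ₃) t) i
                          ≈ coeff (ρ₁ ⊛ u) i + (coeff (ρ₂ ⊛ v) i + coeff (ρ₃ ⊛ w) i)
    coeff-pairing i = trans (coeff-⊕ (ρ₁ ⊛ u) _ i) (+-congˡ (coeff-⊕ (ρ₂ ⊛ v) (ρ₃ ⊛ w) i))
    a∙ : ∀ i → from (α ∙ coordinates i t) ≈ from α₁ * coeff u i + (from α₂ * coeff v i + from α₃ * coeff w i)
    a∙ i = trans (from-∙ α₁ α₂ α₃ _ _ _)
      (+-cong (*-congˡ (from∘to _)) (+-cong (*-congˡ (from∘to _)) (*-congˡ (from∘to _))))
    from-σ′ : ∀ x → from (σ′ (to x)) ≈ σ x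
    from-σ′ x = trans (from∘to _) (σ-cong′ (from∘to x))
    b∙ : from (β ∙ Vec.map σ′ (coordinates 0 t))
         ≈ from β₁ * σ (coeff u 0) + (from β₂ * σ (coeff v 0) + from β₃ * σ (coeff w 0))
    b∙ = trans (from-∙ β₁ β₂ β₃ _ _ _)
      (+-cong (*-congˡ (from-σ′ _)) (+-cong (*-congˡ (from-σ′ _)) (*-congˡ (from-σ′ _))))
    at₀ : coeff (pairing (ρ₁ , ρ₂ , ρ₃) t) 0 ≈ 0#
    at₀ = begin
      coeff (pairing (ρ₁ , ρ₂ , ρ₃) t) 0
        ≈⟨ trans (coeff-pairing 0) (+-cong (coeff₀-⊛ ρ₁ u) (+-cong (coeff₀-⊛ ρ₂ v) (coeff₀-⊛ ρ₃ w))) ⟩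
      from α₁ * coeff u 0 + (from α₂ * coeff v 0 + from α₃ * coeff w 0)
        ≈⟨ a∙ 0 ⟨
      from (α ∙ coordinates 0 t)
        ≈⟨ trans (from-cong eq₀) (from∘to 0#) ⟩
      0# ∎
    at₁ : coeff (pairing (ρ₁ , ρ₂ , ρ₃) t) 1 ≈ 0#
    at₁ = begin
      coeff (pairing (ρ₁ , ρ₂ , ρ₃) t) 1
        ≈⟨ trans (coeff-pairing 1) (+-cong (coeff₁-⊛ ρ₁ u) (+-cong (coeff₁-⊛ ρ₂ v) (coeff₁-⊛ ρ₃ w))) ⟩
      (from α₁ * coeff u 1 + from β₁ * σ (coeff u 0)) + ((from α₂ * coeff v 1 + from β₂ * σ (coeff v 0))
        + (from α₃ * coeff w 1 + from β₃ * σ (coeff w 0)))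
        ≈⟨ solve 6 (λ a b c d e f → (a :+ b) :+ ((c :+ d) :+ (e :+ f)) := (b :+ (d :+ f)) :+ (a :+ (c :+ e))) refl
             (from α₁ * coeff u 1) (from β₁ * σ (coeff u 0)) (from α₂ * coeff v 1) (from β₂ * σ (coeff v 0))
             (from α₃ * coeff w 1) (from β₃ * σ (coeff w 0)) ⟩
      (from β₁ * σ (coeff u 0) + (from β₂ * σ (coeff v 0) + from β₃ * σ (coeff w 0)))
        + (from α₁ * coeff u 1 + (from α₂ * coeff v 1 + from α₃ * coeff w 1))
        ≈⟨ +-cong b∙ (a∙ 1) ⟨
      from (β ∙ Vec.map σ′ (coordinates 0 t)) + from (α ∙ coordinates 1 t)
        ≈⟨ from∘to _ ⟨
      from (β ∙ Vec.map σ′ (coordinates 0 t) ⊕ α ∙ coordinates 1 t)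
        ≈⟨ trans (from-cong eq₁) (from∘to 0#) ⟩
      0# ∎

  -- A vector with zero residue is annihilated by `X`, while freeness of the point would then force
  -- `X` to be zero in `R`.
  residue-≢0 : ∀ P → coordinates 0 (spanning-vector P) ≢ 0ᵛ
  residue-≢0 P eq = 1≉0 (trans (sym (trans (coeff-⊕ X (⊖ []) 1) (+-identityʳ 1#)))
      (proj₂ (ideal-coeff (difference (spanning-vector-torsion-free P X
        (killed u (≡.cong Vec.head eq))
        (killed v (≡.cong (λ x → Vec.head (Vec.tail x)) eq))
        (killed w (≡.cong (λ x → Vec.head (Vec.tail (Vec.tail x))) eq)))))))
    where
    X : Poly
    X = 0# ∷ 1# ∷ []
    u = proj₁ (spanning-vector P)
    v = proj₁ (proj₂ (spanning-vector P))
    w = proj₂ (proj₂ (spanning-vector P))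
    killed : ∀ u → to (coeff u 0) ≡ 0ᴷ → u ⊛ X ≈/ []
    killed u e = coeff⇒≈/ (u ⊛ X) []
      (trans (coeff₀-⊛ u X) (zeroʳ _))
      (trans (coeff₁-⊛ u X) (trans
        (+-cong (trans (*-identityʳ _) (trans (sym (from∘to _)) (trans (from-cong e) (from∘to 0#))))
                (trans (*-congˡ σ-0) (zeroʳ _)))
        (+-identityˡ _)))

  open Plane finiteField automorphism using (R³; inc)
  open PHG R using (Point; ProjectiveArc)

  point-vector : Point → R³
  point-vector P = coordinates 0 (spanning-vector P) , coordinates 1 (spanning-vector P)

  -- Coordinates make incidence decidable, so the indices satisfying the two equations form a
  -- `Subset` to which the arc condition applies; its size is the sum of the products of indicators.
  multiplicity-≤ : ∀ {k n} (arc : ProjectiveArc k n) ℓ → proj₁ ℓ ≢ 0ᵛ →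
    ∑ (allFin k) (λ i → inc ℓ (point-vector (ProjectiveArc.point arc i))) ≤ n
  multiplicity-≤ {k} {n} arc (α , β) α≢0 = ≡.subst (_≤ n)
    (≡.trans (∣tabulate∣ k incident) (∑-cong (allFin k) (λ i → if-∧ (does (on₀ i)) (does (on₁ i)))))
    (arc-bound arc (row α β) (row-unimodular α β α≢0) (Vec.tabulate incident) (λ {i} i∈ → orthogonal i i∈))
    where
    v : Fin k → Triple
    v i = spanning-vector (ProjectiveArc.point arc i)
    on₀ : ∀ i → Dec (α ∙ coordinates 0 (v i) ≡ 0ᴷ)
    on₀ i = α ∙ coordinates 0 (v i) ≟ 0ᴷ
    on₁ : ∀ i → Dec (β ∙ Vec.map σ′ (coordinates 0 (v i)) ⊕ α ∙ coordinates 1 (v i) ≡ 0ᴷ)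
    on₁ i = β ∙ Vec.map σ′ (coordinates 0 (v i)) ⊕ α ∙ coordinates 1 (v i) ≟ 0ᴷ
    incident : Fin k → Bool
    incident i = does (on₀ i ×-dec on₁ i)
    orthogonal : ∀ i → i ∈ˢ Vec.tabulate incident → pairing (row α β) (v i) ≈/ []
    orthogonal i i∈ = let (eq₀ , eq₁) = does-true (on₀ i ×-dec on₁ i)
                                          (≡.trans (≡.sym (Vec.lookup∘tabulate incident i)) (Vec.[]=⇒lookup i∈))
                      in pairing-≈0 α β (v i) eq₀ eq₁

  module _ (g : ℕ) (q≡ : q ≡ Parameters.q₀ g) where
    open Parameters g using (h; s)

    -- The counting is applied to the first `k` points only, which still meet every line in at most
    -- `n` points.
    no-large-arc : ∀ k n d → k ≡ h *ℕ s *ℕ (q *ℕ q +ℕ q +ℕ 1) → n ≡ h *ℕ q → ¬ ProjectiveArc (k +ℕ d) n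
    no-large-arc k n d k≡ n≡ arc = Arc.no-arc finiteField automorphism g
      (≡.trans length≡ q≡) k (λ i → point-vector (point (i ↑ˡ d))) (λ i → residue-≢0 (point (i ↑ˡ d)))
      (≡.trans k≡ (≡.cong (λ q → h *ℕ s *ℕ (q *ℕ q +ℕ q +ℕ 1)) (≡.sym length≡)))
      (λ ℓ ℓ≢0 → ≤-trans (∑-allFin-↑ˡ k d (λ i → inc ℓ (point-vector (point i))))
        (≤-trans (multiplicity-≤ arc ℓ ℓ≢0) (≤-reflexive (≡.trans n≡ (≡.cong (h *ℕ_) (≡.sym length≡))))))
      where
      open ProjectiveArc arc
      length≡ : length (allFin q) ≡ q
      length≡ = length-tabulate {n = q} (λ i → i)

-- Numerical values and the theorem

arc-size : ∀ g {q} → q ≡ Parameters.q₀ g →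
           (q ^ 4 ∸ q) / 2 ≡ Parameters.h g *ℕ Parameters.s g *ℕ (q *ℕ q +ℕ q +ℕ 1)
arc-size g ≡.refl = ≡.trans (≡.cong (_/ 2) (≡.trans (≡.cong (_∸ q₀) (expand g)) (m+n∸n≡m (h *ℕ s *ℕ (q₀ *ℕ q₀ +ℕ q₀ +ℕ 1) *ℕ 2) q₀)))
  (m*n/n≡m (h *ℕ s *ℕ (q₀ *ℕ q₀ +ℕ q₀ +ℕ 1)) 2)
  where
  open Parameters g
  expand : ∀ g → suc (suc (2 *ℕ g)) *ℕ (suc (suc (2 *ℕ g)) *ℕ (suc (suc (2 *ℕ g)) *ℕ (suc (suc (2 *ℕ g)) *ℕ 1))) ≡
    suc g *ℕ suc (2 *ℕ g) *ℕ (suc (suc (2 *ℕ g)) *ℕ suc (suc (2 *ℕ g)) +ℕ suc (suc (2 *ℕ g)) +ℕ 1) *ℕ 2 +ℕ suc (suc (2 *ℕ g))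
  expand = solve-∀

line-size : ∀ g {q} → q ≡ Parameters.q₀ g → q ^ 2 / 2 ≡ Parameters.h g *ℕ q
line-size g ≡.refl = ≡.trans (≡.cong (_/ 2) (expand g)) (m*n/n≡m (h *ℕ q₀) 2)
  where
  open Parameters g
  expand : ∀ g → suc (suc (2 *ℕ g)) *ℕ (suc (suc (2 *ℕ g)) *ℕ 1) ≡ suc g *ℕ suc (suc (2 *ℕ g)) *ℕ 2
  expand = solve-∀

2^suc : ∀ r → ∃ λ g → 2 ^ suc r ≡ Parameters.q₀ g
2^suc zero    = 0 , ≡.refl
-- As `q₀ g = 2 g + 2`, doubling `q` replaces `g` by `q - 1`, which is `s`.
2^suc (suc r) = let (g , eq) = 2^suc r in Parameters.s g , ≡.trans (≡.cong (2 *ℕ_) eq) (*-distribˡ-+ 2 1 (Parameters.s g))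

theorem3p12 : {c ℓ : Level} (r : ℕ) → 1 ≤ r → (F : CommutativeRing c ℓ) → IsFiniteField F (2 ^ r) →
    (σ : Σ (CommutativeRing.Carrier F → CommutativeRing.Carrier F) (IsAutomorphism F)) →
    let q = 2 ^ r
        open PHG (F [X⨟ σ ]/X²)
    in (¬ ProjectiveArc ((q ^ 4 ∸ q) / 2) (q ^ 2 / 2))
       × (∀ m → IsLargestArc (q ^ 2 / 2) m → m < (q ^ 4 ∸ q) / 2)
theorem3p12 (suc r) _ F field-F (σ , σ-aut) =
  (λ arc → no-arc ≤-refl arc) , (λ m largest → ≰⇒> (λ k≤m → no-arc k≤m (proj₁ largest)))
  where
  open PHG (F [X⨟ σ , σ-aut ]/X²) using (ProjectiveArc)
  q = 2 ^ suc r
  g = proj₁ (2^suc r)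
  q≡ = proj₂ (2^suc r)
  -- Formulated for every size from the critical one upwards, so that it excludes both the arc
  -- itself and a largest arc that is not smaller.
  no-arc : ∀ {m} → (q ^ 4 ∸ q) / 2 ≤ m → ¬ ProjectiveArc m (q ^ 2 / 2)
  no-arc {m} k≤m arc = Coordinates.no-large-arc F field-F σ σ-aut g q≡ _ (q ^ 2 / 2) (m ∸ (q ^ 4 ∸ q) / 2)
    (arc-size g q≡) (line-size g q≡) (≡.subst (λ m → ProjectiveArc m (q ^ 2 / 2)) (≡.sym (m+[n∸m]≡n k≤m)) arc)
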